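{- If $G$ is a $t$-clique-sum of graphs $G_1$ and $G_2$ and $r\in\mathbb{N}$, then $\xi_{[r]}(G)=\max\{\xi_{[r]}(G_1),\xi_{[r]}(G_2)\}$.
   Context: A $t$-clique-sum of $G_1$ and $G_2$ is the graph $G=G_1\cup G_2$ (vertex and edge sets the unions) where $G_1$ and $G_2$ intersect exactly in a complete graph $K_t$ (i.e. $V(G_1)\cap V(G_2)$ has $t$ vertices, pairwise adjacent in both, and $G_1,G_2$ are induced subgraphs of $G$). A $(d;r)$ orthogonal subspace representation of $G$ is a family $\{S_u\}_{u\in V(G)}$ of $r$-dimensional subspaces of $\mathbb{C}^d$ with $S_u\perp S_v$ whenever $uv\in E(G)$; $\xi_{[r]}(G)$ is the least $d$ for which one exists. -}

module Defs where

open import Algebra.Bundles using (CommutativeMonoid)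
open import Algebra.Bundles.Raw using (RawRing)
import Algebra.Definitions.RawMonoid as RawMonoidDefs
import Algebra.Properties.CommutativeSemigroup as CommutativeSemigroupProps
open import Data.Fin.Base using (Fin)
open import Data.Fin.Subset using (Subset; _∈_; _∪_; _∩_; ∣_∣)
open import Data.Nat.Base as ℕ using (ℕ)
import Data.Nat.Properties as ℕ
open import Data.Product.Base using (∃; ∃-syntax; Σ-syntax; _×_; _,_; proj₁)
open import Data.Rational.Base as ℚ using (ℚ; 0ℚ; 1ℚ; ½)
import Data.Rational.Properties as ℚ
open import Data.Sum.Base using (_⊎_)
open import Data.Vec.Functional using (Vector)
open import Function.Bundles using (_⇔_)
open import Level using (0ℓ)
open import Relation.Binary.Core using (Rel)
open import Relation.Binary.Definitions using (Decidable; Irreflexive; Symmetric)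
open import Relation.Binary.PropositionalEquality
  using (_≡_; _≢_; refl; sym; trans; cong; cong₂; subst)
open import Relation.Unary using (Pred)

------------------------------------------------------------------------
-- Real numbers: Cauchy sequences of rationals, with equality _≈ᵣ_.

IsCauchy : (ℕ → ℚ) → Set
IsCauchy x = ∀ ε → 0ℚ ℚ.< ε →
  ∃[ N ] (∀ m n → N ℕ.≤ m → N ℕ.≤ n → ℚ.∣ x m ℚ.- x n ∣ ℚ.< ε)

record ℝ : Set where
  constructor mkℝ
  field
    seq    : ℕ → ℚ
    cauchy : IsCauchy seq

open ℝ public

infix 4 _≈ᵣ_ _#ᵣ_

record _≈ᵣ_ (x y : ℝ) : Set where
  constructor mk≈ᵣ
  field
    close : ∀ ε → 0ℚ ℚ.< ε →
      ∃[ N ] (∀ n → N ℕ.≤ n → ℚ.∣ seq x n ℚ.- seq y n ∣ ℚ.< ε)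

-- Apartness, the positive form of inequality (classically, x #ᵣ y if
-- and only if x ≈ᵣ y fails).
_#ᵣ_ : Rel ℝ 0ℓ
x #ᵣ y = ∃[ ε ] (0ℚ ℚ.< ε ×
  ∃[ N ] (∀ n → N ℕ.≤ n → ε ℚ.< ℚ.∣ seq x n ℚ.- seq y n ∣))

private
  open CommutativeSemigroupProps
    (CommutativeMonoid.commutativeSemigroup ℚ.+-0-commutativeMonoid)
    using (interchange)

  p-q+q≡p : ∀ p q → p ℚ.- q ℚ.+ q ≡ p
  p-q+q≡p p q = trans (ℚ.+-assoc p (ℚ.- q) q)
    (trans (cong (p ℚ.+_) (ℚ.+-inverseˡ q)) (ℚ.+-identityʳ p))

  telescope : ∀ p q r → (p ℚ.- q) ℚ.+ (q ℚ.- r) ≡ p ℚ.- r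
  telescope p q r = trans (sym (ℚ.+-assoc (p ℚ.- q) q (ℚ.- r)))
    (cong (ℚ._- r) (p-q+q≡p p q))

  +-sub : ∀ p q r s → (p ℚ.- q) ℚ.+ (r ℚ.- s) ≡ (p ℚ.+ r) ℚ.- (q ℚ.+ s)
  +-sub p q r s = trans (interchange p (ℚ.- q) r (ℚ.- s))
    (cong (p ℚ.+ r ℚ.+_) (sym (ℚ.neg-distrib-+ q s)))

  sub-* : ∀ p q r → (p ℚ.- q) ℚ.* r ≡ p ℚ.* r ℚ.- q ℚ.* r
  sub-* p q r = trans (ℚ.*-distribʳ-+ r p (ℚ.- q))
    (cong (p ℚ.* r ℚ.+_) (sym (ℚ.neg-distribˡ-* q r)))

  *-sub : ∀ p q r s →
    (p ℚ.- q) ℚ.* r ℚ.+ (r ℚ.- s) ℚ.* q ≡ p ℚ.* r ℚ.- q ℚ.* s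
  *-sub p q r s = trans
    (cong₂ ℚ._+_ (sub-* p q r)
      (trans (sub-* r s q) (cong₂ ℚ._-_ (ℚ.*-comm r q) (ℚ.*-comm s q))))
    (telescope (p ℚ.* r) (q ℚ.* r) (q ℚ.* s))

  half+half : ∀ p → ½ ℚ.* p ℚ.+ ½ ℚ.* p ≡ p
  half+half p =
    trans (sym (ℚ.*-distribʳ-+ p ½ ½)) (ℚ.*-identityˡ p)

  half-pos : ∀ {p} → 0ℚ ℚ.< p → 0ℚ ℚ.< ½ ℚ.* p
  half-pos {p} 0<p =
    subst (ℚ._< ½ ℚ.* p) (ℚ.*-zeroʳ ½) (ℚ.*-monoʳ-<-pos ½ 0<p)

  ∣0∣< : ∀ {p ε} → p ≡ 0ℚ → 0ℚ ℚ.< ε → ℚ.∣ p ∣ ℚ.< ε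
  ∣0∣< refl 0<ε = 0<ε

  ∣p+q∣<ε : ∀ {p q ε} → ℚ.∣ p ∣ ℚ.< ½ ℚ.* ε → ℚ.∣ q ∣ ℚ.< ½ ℚ.* ε →
            ℚ.∣ p ℚ.+ q ∣ ℚ.< ε
  ∣p+q∣<ε {p} {q} {ε} p< q< =
    ℚ.≤-<-trans (ℚ.∣p+q∣≤∣p∣+∣q∣ p q)
      (subst (ℚ.∣ p ∣ ℚ.+ ℚ.∣ q ∣ ℚ.<_) (half+half ε) (ℚ.+-mono-< p< q<))

  ∣pq∣<ηB : ∀ {p q η B} → ℚ.∣ p ∣ ℚ.< η → ℚ.∣ q ∣ ℚ.< B →
            ℚ.∣ p ℚ.* q ∣ ℚ.< η ℚ.* B
  ∣pq∣<ηB {p} {q} {η} {B} p< q< =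
    subst (ℚ._< η ℚ.* B) (sym (ℚ.∣p*q∣≡∣p∣*∣q∣ p q))
      (ℚ.≤-<-trans
        (ℚ.*-monoˡ-≤-nonNeg ℚ.∣ p ∣ {{ℚ.∣-∣-nonNeg p}} (ℚ.<⇒≤ q<))
        (ℚ.*-monoˡ-<-pos B
          {{ℚ.positive (ℚ.≤-<-trans (ℚ.0≤∣p∣ q) q<)}} p<))

  eventually-bounded : ∀ x → IsCauchy x →
    ∃[ B ] (0ℚ ℚ.< B × ∃[ N ] (∀ n → N ℕ.≤ n → ℚ.∣ x n ∣ ℚ.< B))
  eventually-bounded x cx with cx 1ℚ (ℚ.positive⁻¹ 1ℚ)
  ... | N , h = 1ℚ ℚ.+ ℚ.∣ x N ∣
    , ℚ.+-mono-<-≤ (ℚ.positive⁻¹ 1ℚ) (ℚ.0≤∣p∣ (x N))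
    , N , λ n N≤n →
      subst (λ p → ℚ.∣ p ∣ ℚ.< 1ℚ ℚ.+ ℚ.∣ x N ∣)
        (p-q+q≡p (x n) (x N))
        (ℚ.≤-<-trans (ℚ.∣p+q∣≤∣p∣+∣q∣ (x n ℚ.- x N) (x N))
          (ℚ.+-monoˡ-< ℚ.∣ x N ∣ (h n N N≤n ℕ.≤-refl)))

  scale : ∀ {ε B} → 0ℚ ℚ.< ε → 0ℚ ℚ.< B →
          ∃[ η ] (0ℚ ℚ.< η × η ℚ.* B ≡ ½ ℚ.* ε)
  scale {ε} {B} 0<ε 0<B =
      ½ ℚ.* ε ℚ.* 1/B
    , ℚ.positive⁻¹ _
        {{ℚ.pos*pos⇒pos (½ ℚ.* ε) {{ℚ.positive (half-pos 0<ε)}}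
                        1/B {{ℚ.1/pos⇒pos B}}}}
    , trans (ℚ.*-assoc (½ ℚ.* ε) 1/B B)
        (trans (cong (½ ℚ.* ε ℚ.*_) (ℚ.*-inverseˡ B))
               (ℚ.*-identityʳ (½ ℚ.* ε)))
    where
    instance
      B-pos     = ℚ.positive 0<B
      B-nonZero = ℚ.pos⇒nonZero B
    1/B = ℚ.1/ B

-- Sealed because only the existence of a modulus matters; unfolding these
-- proofs makes type checking very slow.
abstract
  const-cauchy : ∀ q → IsCauchy (λ _ → q)
  const-cauchy q ε 0<ε = 0 , λ _ _ _ _ → ∣0∣< (ℚ.+-inverseʳ q) 0<ε

  +-cauchy : ∀ x y → IsCauchy x → IsCauchy y → IsCauchy (λ n → x n ℚ.+ y n)
  +-cauchy x y cx cy ε 0<ε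
    with cx (½ ℚ.* ε) (half-pos 0<ε) | cy (½ ℚ.* ε) (half-pos 0<ε)
  ... | M , h | N , k = M ℕ.⊔ N , λ m n m≥ n≥ →
    subst (λ p → ℚ.∣ p ∣ ℚ.< ε)
      (+-sub (x m) (x n) (y m) (y n))
      (∣p+q∣<ε (h m n (ℕ.m⊔n≤o⇒m≤o M N m≥) (ℕ.m⊔n≤o⇒m≤o M N n≥))
               (k m n (ℕ.m⊔n≤o⇒n≤o M N m≥) (ℕ.m⊔n≤o⇒n≤o M N n≥)))

  neg-cauchy : ∀ x → IsCauchy x → IsCauchy (λ n → ℚ.- x n)
  neg-cauchy x cx ε 0<ε with cx ε 0<ε
  ... | N , h = N , λ m n m≥ n≥ →
    subst (ℚ._< ε)
      (trans (sym (ℚ.∣-p∣≡∣p∣ (x m ℚ.- x n)))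
             (cong ℚ.∣_∣ (ℚ.neg-distrib-+ (x m) (ℚ.- x n))))
      (h m n m≥ n≥)

  *-cauchy : ∀ x y → IsCauchy x → IsCauchy y → IsCauchy (λ n → x n ℚ.* y n)
  *-cauchy x y cx cy ε 0<ε
    with eventually-bounded x cx | eventually-bounded y cy
  ... | B , 0<B , M , x<B | C , 0<C , N , y<C
    with scale 0<ε 0<C | scale 0<ε 0<B
  ... | η , 0<η , ηC≡ | θ , 0<θ , θB≡
    with cx η 0<η | cy θ 0<θ
  ... | P , h | Q , k = (M ℕ.⊔ N) ℕ.⊔ (P ℕ.⊔ Q) , λ m n m≥ n≥ →
    let MN≤m = ℕ.m⊔n≤o⇒m≤o (M ℕ.⊔ N) (P ℕ.⊔ Q) m≥
        MN≤n = ℕ.m⊔n≤o⇒m≤o (M ℕ.⊔ N) (P ℕ.⊔ Q) n≥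
        PQ≤m = ℕ.m⊔n≤o⇒n≤o (M ℕ.⊔ N) (P ℕ.⊔ Q) m≥
        PQ≤n = ℕ.m⊔n≤o⇒n≤o (M ℕ.⊔ N) (P ℕ.⊔ Q) n≥
    in
    subst (λ p → ℚ.∣ p ∣ ℚ.< ε)
      (*-sub (x m) (x n) (y m) (y n))
      (∣p+q∣<ε
        (subst (ℚ.∣ (x m ℚ.- x n) ℚ.* y m ∣ ℚ.<_) ηC≡
          (∣pq∣<ηB (h m n (ℕ.m⊔n≤o⇒m≤o P Q PQ≤m) (ℕ.m⊔n≤o⇒m≤o P Q PQ≤n))
                   (y<C m (ℕ.m⊔n≤o⇒n≤o M N MN≤m))))
        (subst (ℚ.∣ (y m ℚ.- y n) ℚ.* x n ∣ ℚ.<_) θB≡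
          (∣pq∣<ηB (k m n (ℕ.m⊔n≤o⇒n≤o P Q PQ≤m) (ℕ.m⊔n≤o⇒n≤o P Q PQ≤n))
                   (x<B n (ℕ.m⊔n≤o⇒m≤o M N MN≤n)))))

infix  8 -ᵣ_
infixl 7 _*ᵣ_
infixl 6 _+ᵣ_

0ᵣ 1ᵣ : ℝ
0ᵣ = mkℝ (λ _ → 0ℚ) (const-cauchy 0ℚ)
1ᵣ = mkℝ (λ _ → 1ℚ) (const-cauchy 1ℚ)

_+ᵣ_ _*ᵣ_ : ℝ → ℝ → ℝ
x +ᵣ y = mkℝ (λ n → seq x n ℚ.+ seq y n)
             (+-cauchy (seq x) (seq y) (cauchy x) (cauchy y))
x *ᵣ y = mkℝ (λ n → seq x n ℚ.* seq y n)
             (*-cauchy (seq x) (seq y) (cauchy x) (cauchy y))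

-ᵣ_ : ℝ → ℝ
-ᵣ x = mkℝ (λ n → ℚ.- seq x n) (neg-cauchy (seq x) (cauchy x))

------------------------------------------------------------------------
-- Complex numbers

infixl 6 _+i_

record ℂ : Set where
  constructor _+i_
  field
    re im : ℝ

open ℂ public

infix  4 _≈_ _#_
infix  8 -_
infixl 7 _*_
infixl 6 _+_

record _≈_ (z w : ℂ) : Set where
  constructor mk≈
  field
    re-≈ : re z ≈ᵣ re w
    im-≈ : im z ≈ᵣ im w

_#_ : Rel ℂ 0ℓ
z # w = re z #ᵣ re w ⊎ im z #ᵣ im w

0# 1# : ℂ
0# = 0ᵣ +i 0ᵣ
1# = 1ᵣ +i 0ᵣ

_+_ _*_ : ℂ → ℂ → ℂ
z + w = (re z +ᵣ re w) +i (im z +ᵣ im w)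
z * w = (re z *ᵣ re w +ᵣ -ᵣ (im z *ᵣ im w)) +i
        (re z *ᵣ im w +ᵣ im z *ᵣ re w)

-_ conj : ℂ → ℂ
- z = (-ᵣ re z) +i (-ᵣ im z)
conj z = re z +i (-ᵣ im z)

ℂ-rawRing : RawRing 0ℓ 0ℓ
ℂ-rawRing = record
  { Carrier = ℂ ; _≈_ = _≈_ ; _+_ = _+_ ; _*_ = _*_ ; -_ = -_
  ; 0# = 0# ; 1# = 1# }

open RawMonoidDefs (RawRing.+-rawMonoid ℂ-rawRing) public using (sum)

------------------------------------------------------------------------
-- The Hermitian space ℂᵈ and its subspaces

ℂ^_ : ℕ → Set
ℂ^ d = Vector ℂ d

infix  4 _≈ᵥ_
infixl 6 _+ᵥ_
infixr 7 _*ᵥ_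

_≈ᵥ_ : ∀ {d} → Rel (ℂ^ d) 0ℓ
v ≈ᵥ w = ∀ i → v i ≈ w i

0ᵥ : ∀ {d} → ℂ^ d
0ᵥ _ = 0#

_+ᵥ_ : ∀ {d} → ℂ^ d → ℂ^ d → ℂ^ d
(v +ᵥ w) i = v i + w i

_*ᵥ_ : ∀ {d} → ℂ → ℂ^ d → ℂ^ d
(c *ᵥ v) i = c * v i

⟨_,_⟩ : ∀ {d} → ℂ^ d → ℂ^ d → ℂ
⟨ v , w ⟩ = sum (λ i → conj (v i) * w i)

combination : ∀ {r d} → Vector ℂ r → Vector (ℂ^ d) r → ℂ^ d
combination c b i = sum (λ j → c j * b j i)

record Subspace (d : ℕ) : Set₁ where
  field
    Member   : Pred (ℂ^ d) 0ℓ
    resp-≈   : ∀ {v w} → v ≈ᵥ w → Member v → Member w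
    0-closed : Member 0ᵥ
    +-closed : ∀ {v w} → Member v → Member w → Member (v +ᵥ w)
    *-closed : ∀ c {v} → Member v → Member (c *ᵥ v)

open Subspace public

-- Constructive form of linear independence: coefficients that are not
-- all zero give a nonzero combination, with "nonzero" read as apartness.
-- Classically this is the contrapositive of the usual definition.
LinearlyIndependent : ∀ {r d} → Vector (ℂ^ d) r → Set
LinearlyIndependent {r} b = ∀ (c : Vector ℂ r) →
  (∃[ j ] c j # 0#) → ∃[ i ] combination c b i # 0#

record IsBasis {r d} (S : Subspace d) (b : Vector (ℂ^ d) r) : Set where
  field
    members     : ∀ j → Member S (b j)
    independent : LinearlyIndependent b
    spanning    : ∀ {v} → Member S v → ∃[ c ] v ≈ᵥ combination c b

HasDimension : ∀ {d} → Subspace d → ℕ → Set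
HasDimension {d} S r = Σ[ b ∈ Vector (ℂ^ d) r ] IsBasis S b

infix 4 _⊥_

_⊥_ : ∀ {d} → Subspace d → Subspace d → Set
S ⊥ T = ∀ {v w} → Member S v → Member T w → ⟨ v , w ⟩ ≈ 0#

------------------------------------------------------------------------
-- Finite simple graphs

-- The vertex set is a subset of an ambient finite set Fin N, so that
-- different graphs can share vertices and be intersected and united.
record Graph (N : ℕ) : Set₁ where
  field
    V        : Subset N
    Adj      : Rel (Fin N) 0ℓ
    adj?     : Decidable Adj
    adj-sym  : Symmetric Adj
    adj-irr  : Irreflexive _≡_ Adj
    adj-∈    : ∀ {u v} → Adj u v → u ∈ V × v ∈ V

  Vertex : Set
  Vertex = ∃[ u ] u ∈ V

open Graph public

record IsInducedSubgraph {N} (H G : Graph N) : Set where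
  field
    vertices : ∀ {u} → u ∈ V H → u ∈ V G
    edges    : ∀ {u v} → u ∈ V H → v ∈ V H → Adj H u v ⇔ Adj G u v

record IsCliqueSum {N} (t : ℕ) (G₁ G₂ G : Graph N) : Set where
  field
    vertices  : V G ≡ V G₁ ∪ V G₂
    edges     : ∀ u v → Adj G u v ⇔ (Adj G₁ u v ⊎ Adj G₂ u v)
    order     : ∣ V G₁ ∩ V G₂ ∣ ≡ t
    complete  : ∀ {u v} → u ∈ V G₁ ∩ V G₂ → v ∈ V G₁ ∩ V G₂ → u ≢ v →
                Adj G₁ u v × Adj G₂ u v
    induced₁  : IsInducedSubgraph G₁ G
    induced₂  : IsInducedSubgraph G₂ G

------------------------------------------------------------------------
-- Orthogonal subspace representations

record OrthogonalSubspaceRep {N} (d r : ℕ) (G : Graph N) : Set₁ where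
  field
    space      : Vertex G → Subspace d
    dimension  : ∀ u → HasDimension (space u) r
    orthogonal : ∀ u v → Adj G (proj₁ u) (proj₁ v) → space u ⊥ space v

-- ξ[ r ] G ≔ d says that d is the least dimension admitting a (d ; r)
-- representation, i.e. ξ_[r](G) = d.  It is a relation because the least
-- element of an inhabited set of naturals exists only classically.
infix 4 ξ[_]_≔_

record ξ[_]_≔_ {N} (r : ℕ) (G : Graph N) (d : ℕ) : Set₁ where
  field
    attained : OrthogonalSubspaceRep d r G
    least    : ∀ d′ → OrthogonalSubspaceRep d′ r G → d ℕ.≤ d′

ξ-unique : ∀ {N r} {G : Graph N} {d d′} →
           ξ[ r ] G ≔ d → ξ[ r ] G ≔ d′ → d ≡ d′
ξ-unique {d = d} {d′} p q =
  ℕ.≤-antisym (least p d′ (attained q)) (least q d (attained p))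
  where open ξ[_]_≔_

{-# OPTIONS --safe #-}
-- The lower bound holds because a representation of G restricts to the
-- induced subgraphs G₁ and G₂.  For the upper bound, pad representations of
-- G₁ and G₂ by zero coordinates to the common dimension d₁ ⊔ d₂ and apply to
-- the second one a unitary map U that moves its spaces at the shared
-- vertices onto those of the first; as these spaces are pairwise orthogonal
-- on both sides, U can be composed of one factor per shared vertex.  Such a
-- factor is in turn a product of complex Householder maps, one for each
-- Gram–Schmidt vector of a basis, each of which fixes everything orthogonal
-- to the two vectors it matches.  No extension to a basis of the whole space
-- is needed, which keeps the argument constructive.  The only analytic
-- ingredient is the reciprocal square root of a positive real.
module Submission where

open import Defs
open import Data.Nat.Base using (ℕ; _⊔_)

open import Algebra.Bundles using (CommutativeRing)
import Algebra.Properties.AbelianGroup as AbelianGroupProperties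
import Algebra.Properties.CommutativeMonoid.Sum as CommutativeMonoidSum
import Algebra.Properties.Semiring.Sum as SemiringSum
import Algebra.Solver.Ring as RingSolver
open import Algebra.Solver.Ring.AlmostCommutativeRing
  using (fromCommutativeRing; _-Raw-AlmostCommutative⟶_; Induced-equivalence)
open import Data.Fin.Base using (Fin; zero; suc)
open import Data.Fin.Subset using (_∈_)
open import Data.Fin.Subset.Properties using (_∈?_; x∈p∪q⁻; x∈p∩q⁺)
open import Data.Integer.Base as ℤ using (ℤ)
import Data.Integer.Properties as ℤ
import Data.Maybe.Base as Maybe
open import Data.Nat.Base as ℕ using (zero; suc)
import Data.Nat.Properties as ℕ
open import Data.Product.Base using (∃-syntax; Σ-syntax; _×_; _,_; proj₁; proj₂)
open import Data.Rational.Base as ℚ using (ℚ; 0ℚ; 1ℚ; ½)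
import Data.Rational.Properties as ℚ
open import Data.Rational.Solver using (module +-*-Solver)
import Data.Rational.Unnormalised.Base as ℚᵘ
import Data.Rational.Unnormalised.Properties as ℚᵘ
open import Data.Sum.Base as Sum using (_⊎_; inj₁; inj₂; [_,_]′)
open import Data.Vec.Functional using (Vector; _∷_; tail)
open import Function.Base using (_∘_)
open import Function.Bundles using (Equivalence)
open import Level using (0ℓ)
open import Relation.Binary.Consequences using (dec⇒weaklyDec)
open import Relation.Binary.PropositionalEquality
  using (_≡_; _≢_; refl; sym; trans; cong; cong₂; subst; subst₂)
open import Relation.Binary.Definitions using (WeaklyDecidable)
import Relation.Binary.Reasoning.Setoid as SetoidReasoning
open import Relation.Binary.Structures using (IsEquivalence)
open import Relation.Nullary using (Dec; yes; no; ¬_; contradiction)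
open import Relation.Nullary.Decidable using (_×-dec_)
open import Relation.Unary using (Decidable; Pred)

-- Rational and real numbers

-- Equality and apartness in ℂ cannot be decided, so no step may ask whether a vector vanishes or
-- whether two vectors coincide. A plain reflection taking `f` to `e` breaks here: it divides by a
-- quantity that vanishes when `f` and `e` agree. Only the line through `f` has to be moved, so `f`
-- may first be multiplied by a phase `ω` that keeps the divisor `1 - ω⟨e,f⟩` away from zero. The
-- other division, by the length of a vector, is licensed by linear independence in its apartness
-- form, which makes the squared norm positive. The goal set for the unitary map is an inclusion: at
-- each shared vertex the first space lies in the image of the second. Keeping the first space there
-- serves both kinds of edges, since every edge of `G` comes from `G₁` or `G₂` and orthogonality
-- passes to smaller spaces.

module Reals where

  open +-*-Solver using (solve; _:+_; _:*_; _:-_; :-_; _:=_; con)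

  ¼ : ℚ
  ¼ = ½ ℚ.* ½

  *-mono-≤-nonNeg : ∀ {p q r s} → 0ℚ ℚ.≤ r → 0ℚ ℚ.≤ q → p ℚ.≤ q → r ℚ.≤ s → p ℚ.* r ℚ.≤ q ℚ.* s
  *-mono-≤-nonNeg {p} {q} {r} {s} 0≤r 0≤q p≤q r≤s = ℚ.≤-trans
    (ℚ.*-monoʳ-≤-nonNeg r {{ℚ.nonNegative 0≤r}} p≤q)
    (ℚ.*-monoˡ-≤-nonNeg q {{ℚ.nonNegative 0≤q}} r≤s)

  0<* : ∀ {p q} → 0ℚ ℚ.< p → 0ℚ ℚ.< q → 0ℚ ℚ.< p ℚ.* q
  0<* {p} {q} 0<p 0<q = ℚ.positive⁻¹ _
    {{ℚ.pos*pos⇒pos p {{ℚ.positive 0<p}} q {{ℚ.positive 0<q}}}}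

  0≤* : ∀ {p q} → 0ℚ ℚ.≤ p → 0ℚ ℚ.≤ q → 0ℚ ℚ.≤ p ℚ.* q
  0≤* {p} {q} 0≤p 0≤q = ℚ.nonNegative⁻¹ _
    {{ℚ.nonNeg*nonNeg⇒nonNeg p {{ℚ.nonNegative 0≤p}} q {{ℚ.nonNegative 0≤q}}}}

  0<½* : ∀ {p} → 0ℚ ℚ.< p → 0ℚ ℚ.< ½ ℚ.* p
  0<½* = 0<* (ℚ.positive⁻¹ ½)

  ½+½ : ∀ p → ½ ℚ.* p ℚ.+ ½ ℚ.* p ≡ p
  ½+½ = solve 1 (λ p → con ½ :* p :+ con ½ :* p := p) refl

  0≤p*p : ∀ p → 0ℚ ℚ.≤ p ℚ.* p
  0≤p*p p with ℚ.≤-total 0ℚ p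
  ... | inj₁ 0≤p = 0≤* 0≤p 0≤p
  ... | inj₂ p≤0 = ℚ.nonNegative⁻¹ _
    {{ℚ.nonPos*nonPos⇒nonPos p {{ℚ.nonPositive p≤0}} p {{ℚ.nonPositive p≤0}}}}

  ∣p∣*∣p∣≡p*p : ∀ p → ℚ.∣ p ∣ ℚ.* ℚ.∣ p ∣ ≡ p ℚ.* p
  ∣p∣*∣p∣≡p*p p = trans (sym (ℚ.∣p*q∣≡∣p∣*∣q∣ p p)) (ℚ.0≤p⇒∣p∣≡p (0≤p*p p))

  p≤∣p∣ : ∀ p → p ℚ.≤ ℚ.∣ p ∣
  p≤∣p∣ p with ℚ.≤-total 0ℚ p
  ... | inj₁ 0≤p = ℚ.≤-reflexive (sym (ℚ.0≤p⇒∣p∣≡p 0≤p))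
  ... | inj₂ p≤0 = ℚ.≤-trans p≤0 (ℚ.0≤∣p∣ p)

  ∣p-q∣≡∣q-p∣ : ∀ p q → ℚ.∣ p ℚ.- q ∣ ≡ ℚ.∣ q ℚ.- p ∣
  ∣p-q∣≡∣q-p∣ p q = trans (sym (ℚ.∣-p∣≡∣p∣ (p ℚ.- q)))
    (cong ℚ.∣_∣ (solve 2 (λ p q → :- (p :- q) := q :- p) refl p q))

  ∣p-q∣<ε⇒p<q+ε : ∀ {p q ε} → ℚ.∣ p ℚ.- q ∣ ℚ.< ε → p ℚ.< q ℚ.+ ε
  ∣p-q∣<ε⇒p<q+ε {p} {q} {ε} h =
    subst (ℚ._< q ℚ.+ ε) (solve 2 (λ p q → q :+ (p :- q) := p) refl p q)
      (ℚ.+-monoʳ-< q (ℚ.≤-<-trans (p≤∣p∣ (p ℚ.- q)) h))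

  <-square-cancel : ∀ {p q} → 0ℚ ℚ.≤ q → p ℚ.* p ℚ.< q ℚ.* q → p ℚ.< q
  <-square-cancel {p} {q} 0≤q p²<q² with p ℚ.<? q
  ... | yes p<q = p<q
  ... | no p≮q = contradiction
    (ℚ.<-≤-trans p²<q² (*-mono-≤-nonNeg 0≤q (ℚ.≤-trans 0≤q q≤p) q≤p q≤p))
    (ℚ.<-irrefl refl)
    where q≤p = ℚ.≮⇒≥ p≮q

  reciprocal : ∀ {p} → 0ℚ ℚ.< p → ∃[ t ] (0ℚ ℚ.< t × p ℚ.* t ≡ 1ℚ)
  reciprocal {p} 0<p = ℚ.1/ p , ℚ.positive⁻¹ _ {{ℚ.1/pos⇒pos p}} , ℚ.*-inverseʳ p
    where
    instance
      p-pos     = ℚ.positive 0<p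
      p-nonZero = ℚ.pos⇒nonZero p

  -- The Archimedean property and Newton iteration for rational square roots

  ι : ℕ → ℚ
  ι zero    = 0ℚ
  ι (suc n) = 1ℚ ℚ.+ ι n

  0≤ι : ∀ n → 0ℚ ℚ.≤ ι n
  0≤ι zero    = ℚ.≤-refl
  0≤ι (suc n) = ℚ.+-mono-≤ (ℚ.nonNegative⁻¹ 1ℚ) (0≤ι n)

  0<ι : ∀ n → 0ℚ ℚ.< ι (suc n)
  0<ι n = ℚ.+-mono-<-≤ (ℚ.positive⁻¹ 1ℚ) (0≤ι n)

  ι-mono-≤ : ∀ {m n} → m ℕ.≤ n → ι m ℚ.≤ ι n
  ι-mono-≤ {n = n} ℕ.z≤n = 0≤ι n
  ι-mono-≤ (ℕ.s≤s m≤n)   = ℚ.+-monoʳ-≤ 1ℚ (ι-mono-≤ m≤n)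

  toℚᵘ-ι : ∀ n → ℚ.toℚᵘ (ι n) ℚᵘ.≃ ℚᵘ.mkℚᵘ (ℤ.+ n) 0
  toℚᵘ-ι zero    = ℚᵘ.≃-refl
  toℚᵘ-ι (suc n) = ℚᵘ.≃-trans (ℚ.toℚᵘ-homo-+ 1ℚ (ι n))
    (ℚᵘ.≃-trans (ℚᵘ.+-congʳ (ℚ.toℚᵘ 1ℚ) (toℚᵘ-ι n))
      (ℚᵘ.*≡* (cong (λ i → (ℤ.+ 1 ℤ.+ i) ℤ.* ℤ.+ 1) (ℤ.*-identityʳ (ℤ.+ n)))))

  -- The denominator is at least 1, so `p` is at most the absolute value of its numerator.
  p<ι : ∀ p → p ℚ.< ι (suc ℤ.∣ ℚ.↥ p ∣)
  p<ι p@record{} = ℚ.toℚᵘ-cancel-< (ℚᵘ.<-respʳ-≃ (ℚᵘ.≃-sym (toℚᵘ-ι (suc ∣n∣))) (ℚᵘ.*<*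
    (ℤ.≤-<-trans (ℤ.≤-trans (ℤ.≤-reflexive (ℤ.*-identityʳ (ℚ.↥ p))) (i≤∣i∣ (ℚ.↥ p)))
      (ℤ.+<+ (ℕ.<-≤-trans (ℕ.n<1+n ∣n∣) (ℕ.m≤m*n (suc ∣n∣) (ℚ.↧ₙ p)))))))
    where
    ∣n∣ = ℤ.∣ ℚ.↥ p ∣
    i≤∣i∣ : ∀ i → i ℤ.≤ ℤ.+ ℤ.∣ i ∣
    i≤∣i∣ (ℤ.+ n)      = ℤ.≤-refl
    i≤∣i∣ ℤ.-[1+ n ] = ℤ.-≤+

  archimedean : ∀ p {q} → 0ℚ ℚ.< q → ∃[ n ] p ℚ.< ι n ℚ.* q
  archimedean p {q} 0<q with reciprocal 0<q
  ... | t , _ , qt≡1 = suc ℤ.∣ ℚ.↥ (p ℚ.* t) ∣ , subst (ℚ._< ι (suc ℤ.∣ ℚ.↥ (p ℚ.* t) ∣) ℚ.* q)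
    (trans (solve 3 (λ p q t → p :* t :* q := p :* (q :* t)) refl p q t)
      (trans (cong (p ℚ.*_) qt≡1) (ℚ.*-identityʳ p)))
    (ℚ.*-monoˡ-<-pos q {{ℚ.positive 0<q}} (p<ι (p ℚ.* t)))

  -- Heron's step, with `t = 1/s`: the new error is exactly `¼(s - q/s)²`, hence nonnegative.
  -- Expanding the square gives `s² - 2q + q²/s²`, and `q ≤ s²` bounds the last term by `q`, so the
  -- error shrinks at least fourfold.
  newton-step : ∀ {q s} → 0ℚ ℚ.< q → 0ℚ ℚ.< s → q ℚ.≤ s ℚ.* s →
    ∃[ s′ ] (0ℚ ℚ.< s′ × q ℚ.≤ s′ ℚ.* s′ × s′ ℚ.* s′ ℚ.- q ℚ.≤ ¼ ℚ.* (s ℚ.* s ℚ.- q))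
  newton-step {q} {s} 0<q 0<s q≤s² with reciprocal 0<s
  ... | t , 0<t , st≡1 = s′ , 0<s′ , q≤s′² , bound
    where
    s′ d : ℚ
    s′ = ½ ℚ.* (s ℚ.+ q ℚ.* t)
    d  = s ℚ.- q ℚ.* t

    0<s′ : 0ℚ ℚ.< s′
    0<s′ = 0<½* (ℚ.+-mono-< 0<s (0<* 0<q 0<t))

    s′² : s′ ℚ.* s′ ≡ q ℚ.+ ¼ ℚ.* (d ℚ.* d)
    s′² = trans
      (solve 3 (λ q s t → con ½ :* (s :+ q :* t) :* (con ½ :* (s :+ q :* t)) :=
        q :* (s :* t) :+ con ¼ :* ((s :- q :* t) :* (s :- q :* t))) refl q s t)
      (cong (λ x → x ℚ.+ ¼ ℚ.* (d ℚ.* d)) (trans (cong (q ℚ.*_) st≡1) (ℚ.*-identityʳ q)))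

    q≤s′² : q ℚ.≤ s′ ℚ.* s′
    q≤s′² = subst₂ ℚ._≤_ (ℚ.+-identityʳ q) (sym s′²)
      (ℚ.+-monoʳ-≤ q (0≤* (ℚ.nonNegative⁻¹ ¼) (0≤p*p d)))

    d² : d ℚ.* d ≡ (s ℚ.* s ℚ.- q ℚ.- q) ℚ.+ q ℚ.* (q ℚ.* (t ℚ.* t))
    d² = trans
      (solve 3 (λ q s t → (s :- q :* t) :* (s :- q :* t) :=
        (s :* s :- q :* (s :* t) :- q :* (s :* t)) :+ q :* (q :* (t :* t))) refl q s t)
      (cong (λ x → (s ℚ.* s ℚ.- x ℚ.- x) ℚ.+ q ℚ.* (q ℚ.* (t ℚ.* t)))
        (trans (cong (q ℚ.*_) st≡1) (ℚ.*-identityʳ q)))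

    qt²≤1 : q ℚ.* (t ℚ.* t) ℚ.≤ 1ℚ
    qt²≤1 = subst (q ℚ.* (t ℚ.* t) ℚ.≤_)
      (trans (solve 2 (λ s t → s :* s :* (t :* t) := s :* t :* (s :* t)) refl s t)
        (cong (λ x → x ℚ.* x) st≡1))
      (ℚ.*-monoʳ-≤-nonNeg (t ℚ.* t) {{ℚ.nonNegative (0≤p*p t)}} q≤s²)

    d²≤ : d ℚ.* d ℚ.≤ s ℚ.* s ℚ.- q
    d²≤ = subst₂ ℚ._≤_ (sym d²)
      (solve 2 (λ q s → (s :* s :- q :- q) :+ q :* con 1ℚ := s :* s :- q) refl q s)
      (ℚ.+-monoʳ-≤ (s ℚ.* s ℚ.- q ℚ.- q)
        (ℚ.*-monoˡ-≤-nonNeg q {{ℚ.nonNegative (ℚ.<⇒≤ 0<q)}} qt²≤1))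

    bound : s′ ℚ.* s′ ℚ.- q ℚ.≤ ¼ ℚ.* (s ℚ.* s ℚ.- q)
    bound = subst (ℚ._≤ ¼ ℚ.* (s ℚ.* s ℚ.- q))
      (sym (trans (cong (ℚ._- q) s′²)
        (solve 2 (λ q x → q :+ x :- q := x) refl q (¼ ℚ.* (d ℚ.* d)))))
      (ℚ.*-monoˡ-≤-nonNeg ¼ d²≤)

  -- Because `n + 2 ≤ 2(n + 1)`, the gain of a factor 4 outweighs the larger multiplier.
  ι-suc-*-¼ : ∀ n {e e′} → 0ℚ ℚ.≤ e → 0ℚ ℚ.≤ e′ → e′ ℚ.≤ ¼ ℚ.* e →
    ι (2 ℕ.+ n) ℚ.* e′ ℚ.≤ ι (suc n) ℚ.* e
  ι-suc-*-¼ n {e} {e′} 0≤e 0≤e′ e′≤¼e = begin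
    (1ℚ ℚ.+ k) ℚ.* e′
      ≤⟨ ℚ.*-monoʳ-≤-nonNeg e′ {{ℚ.nonNegative 0≤e′}} (ℚ.+-monoˡ-≤ k 1≤k) ⟩
    (k ℚ.+ k) ℚ.* e′
      ≤⟨ ℚ.*-monoˡ-≤-nonNeg (k ℚ.+ k) {{ℚ.nonNegative (ℚ.+-mono-≤ 0≤k 0≤k)}} e′≤¼e ⟩
    (k ℚ.+ k) ℚ.* (¼ ℚ.* e)
      ≡⟨ solve 2 (λ k e → (k :+ k) :* (con ¼ :* e) := con ½ :* (k :* e)) refl k e ⟩
    ½ ℚ.* (k ℚ.* e)
      ≤⟨ ℚ.*-monoʳ-≤-nonNeg (k ℚ.* e) {{ℚ.nonNegative (0≤* 0≤k 0≤e)}} (ℚ.≤ᵇ⇒≤ {½} {1ℚ} _) ⟩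
    1ℚ ℚ.* (k ℚ.* e)
      ≡⟨ ℚ.*-identityˡ _ ⟩
    k ℚ.* e ∎
    where
    open ℚ.≤-Reasoning
    k = ι (suc n)
    0≤k = 0≤ι (suc n)
    1≤k : 1ℚ ℚ.≤ k
    1≤k = subst (ℚ._≤ k) (ℚ.+-identityʳ 1ℚ) (ℚ.+-monoʳ-≤ 1ℚ (0≤ι n))

  0≤q-p : ∀ {p q} → p ℚ.≤ q → 0ℚ ℚ.≤ q ℚ.- p
  0≤q-p {p} {q} p≤q = subst (ℚ._≤ q ℚ.- p) (ℚ.+-inverseʳ p) (ℚ.+-monoˡ-≤ (ℚ.- p) p≤q)

  -- The constant `1 + q + q²` is the error `(1 + q)² - q` of the starting value `1 + q`. The
  -- harmonic decay is much weaker than what the iteration achieves, but the Archimedean property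
  -- alone turns it into any prescribed accuracy.
  NewtonApprox : ℚ → ℕ → Set
  NewtonApprox q n = ∃[ s ] (0ℚ ℚ.< s × q ℚ.≤ s ℚ.* s ×
    ι (suc n) ℚ.* (s ℚ.* s ℚ.- q) ℚ.≤ 1ℚ ℚ.+ q ℚ.+ q ℚ.* q)

  newton-start : ∀ {q} → 0ℚ ℚ.< q → NewtonApprox q 0
  newton-start {q} 0<q = 1ℚ ℚ.+ q , ℚ.+-mono-< (ℚ.positive⁻¹ 1ℚ) 0<q
    , subst₂ ℚ._≤_ (ℚ.+-identityʳ q)
        (solve 1 (λ q → q :+ (con 1ℚ :+ q :+ q :* q) := (con 1ℚ :+ q) :* (con 1ℚ :+ q)) refl q)
        (ℚ.+-monoʳ-≤ q (ℚ.<⇒≤ (ℚ.+-mono-< (ℚ.+-mono-< (ℚ.positive⁻¹ 1ℚ) 0<q) (0<* 0<q 0<q))))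
    , ℚ.≤-reflexive (solve 1 (λ q → con 1ℚ :* ((con 1ℚ :+ q) :* (con 1ℚ :+ q) :- q) :=
        con 1ℚ :+ q :+ q :* q) refl q)

  newton-next : ∀ {q n} → 0ℚ ℚ.< q → NewtonApprox q n → NewtonApprox q (suc n)
  newton-next {n = n} 0<q (s , 0<s , q≤s² , h) =
    let s′ , 0<s′ , q≤s′² , k = newton-step 0<q 0<s q≤s²
    in s′ , 0<s′ , q≤s′² , ℚ.≤-trans (ι-suc-*-¼ n (0≤q-p q≤s²) (0≤q-p q≤s′²) k) h

  newton : ∀ {q} → 0ℚ ℚ.< q → ∀ n → NewtonApprox q n
  newton 0<q zero    = newton-start 0<q
  newton 0<q (suc n) = newton-next {n = n} 0<q (newton 0<q n)

  -- Sealed because unfolding the iterates makes type checking very slow.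
  abstract
    sqrt-approx : ∀ {q η} → 0ℚ ℚ.< q → 0ℚ ℚ.< η →
      ∃[ s ] (0ℚ ℚ.< s × q ℚ.≤ s ℚ.* s × s ℚ.* s ℚ.- q ℚ.< η)
    sqrt-approx {q} {η} 0<q 0<η =
      let n , C<nη = archimedean (1ℚ ℚ.+ q ℚ.+ q ℚ.* q) 0<η in accurate n C<nη (newton 0<q n)
      where
      accurate : ∀ n → 1ℚ ℚ.+ q ℚ.+ q ℚ.* q ℚ.< ι n ℚ.* η → NewtonApprox q n →
        ∃[ s ] (0ℚ ℚ.< s × q ℚ.≤ s ℚ.* s × s ℚ.* s ℚ.- q ℚ.< η)
      accurate n C<nη (s , 0<s , q≤s² , h) = s , 0<s , q≤s² ,
        ℚ.*-cancelˡ-<-nonNeg (ι (suc n)) {{ℚ.nonNegative (0≤ι (suc n))}}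
          (ℚ.≤-<-trans h (ℚ.<-≤-trans C<nη
            (ℚ.*-monoʳ-≤-nonNeg η {{ℚ.nonNegative (ℚ.<⇒≤ 0<η)}} (ι-mono-≤ (ℕ.n≤1+n n)))))

  +-cancelʳ-< : ∀ r {p q} → p ℚ.+ r ℚ.< q ℚ.+ r → p ℚ.< q
  +-cancelʳ-< r {p} {q} h = subst₂ ℚ._<_ (cancel p) (cancel q) (ℚ.+-monoˡ-< (ℚ.- r) h)
    where
    cancel : ∀ x → x ℚ.+ r ℚ.- r ≡ x
    cancel x = solve 2 (λ x r → x :+ r :- r := x) refl x r

  +-cancelˡ-< : ∀ r {p q} → r ℚ.+ p ℚ.< r ℚ.+ q → p ℚ.< q
  +-cancelˡ-< r {p} {q} h = +-cancelʳ-< r (subst₂ ℚ._<_ (ℚ.+-comm r p) (ℚ.+-comm r q) h)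

  -- Null sequences and the arithmetic of real equality

  Eventually : (ℕ → Set) → Set
  Eventually P = ∃[ N ] (∀ n → N ℕ.≤ n → P n)

  ev-map : ∀ {P Q : ℕ → Set} → (∀ n → P n → Q n) → Eventually P → Eventually Q
  ev-map f (N , p) = N , λ n N≤n → f n (p n N≤n)

  ev-zip : ∀ {P Q R : ℕ → Set} → (∀ n → P n → Q n → R n) →
    Eventually P → Eventually Q → Eventually R
  ev-zip f (M , p) (N , q) = M ℕ.⊔ N , λ n h →
    f n (p n (ℕ.m⊔n≤o⇒m≤o M N h)) (q n (ℕ.m⊔n≤o⇒n≤o M N h))

  Null : (ℕ → ℚ) → Set
  Null f = ∀ ε → 0ℚ ℚ.< ε → Eventually (λ n → ℚ.∣ f n ∣ ℚ.< ε)

  Bounded : (ℕ → ℚ) → Set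
  Bounded f = ∃[ B ] (0ℚ ℚ.< B × Eventually (λ n → ℚ.∣ f n ∣ ℚ.< B))

  null-cong : ∀ {f g} → (∀ n → f n ≡ g n) → Null f → Null g
  null-cong f≡g h ε 0<ε = ev-map (λ n → subst (λ p → ℚ.∣ p ∣ ℚ.< ε) (f≡g n)) (h ε 0<ε)

  ∣p+q∣<½ε+½ε : ∀ {p q ε} → ℚ.∣ p ∣ ℚ.< ½ ℚ.* ε → ℚ.∣ q ∣ ℚ.< ½ ℚ.* ε → ℚ.∣ p ℚ.+ q ∣ ℚ.< ε
  ∣p+q∣<½ε+½ε {p} {q} {ε} p< q< = ℚ.≤-<-trans (ℚ.∣p+q∣≤∣p∣+∣q∣ p q)
    (subst (ℚ.∣ p ∣ ℚ.+ ℚ.∣ q ∣ ℚ.<_) (½+½ ε) (ℚ.+-mono-< p< q<))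

  null-+ : ∀ {f g} → Null f → Null g → Null (λ n → f n ℚ.+ g n)
  null-+ hf hg ε 0<ε = ev-zip (λ n → ∣p+q∣<½ε+½ε)
    (hf (½ ℚ.* ε) (0<½* 0<ε)) (hg (½ ℚ.* ε) (0<½* 0<ε))

  null-neg : ∀ {f} → Null f → Null (λ n → ℚ.- f n)
  null-neg {f} h ε 0<ε =
    ev-map (λ n → subst (ℚ._< ε) (sym (ℚ.∣-p∣≡∣p∣ (f n)))) (h ε 0<ε)

  ∣p*q∣<p′*q′ : ∀ {p q p′ q′} → ℚ.∣ p ∣ ℚ.< p′ → ℚ.∣ q ∣ ℚ.< q′ → ℚ.∣ p ℚ.* q ∣ ℚ.< p′ ℚ.* q′
  ∣p*q∣<p′*q′ {p} {q} {p′} {q′} p< q< = subst (ℚ._< p′ ℚ.* q′) (sym (ℚ.∣p*q∣≡∣p∣*∣q∣ p q))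
    (ℚ.≤-<-trans (ℚ.*-monoˡ-≤-nonNeg ℚ.∣ p ∣ {{ℚ.∣-∣-nonNeg p}} (ℚ.<⇒≤ q<))
      (ℚ.*-monoˡ-<-pos q′ {{ℚ.positive (ℚ.≤-<-trans (ℚ.0≤∣p∣ q) q<)}} p<))

  *-cancel-reciprocal : ∀ p {q t} → q ℚ.* t ≡ 1ℚ → p ℚ.* t ℚ.* q ≡ p
  *-cancel-reciprocal p {q} {t} qt≡1 =
    trans (solve 3 (λ p q t → p :* t :* q := p :* (q :* t)) refl p q t)
      (trans (cong (p ℚ.*_) qt≡1) (ℚ.*-identityʳ p))

  null-* : ∀ {f g} → Null f → Bounded g → Null (λ n → f n ℚ.* g n)
  null-* {f} {g} hf (B , 0<B , hg) ε 0<ε =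
    let t , 0<t , Bt≡1 = reciprocal 0<B in ev-zip
      (λ n f< g< → subst (ℚ.∣ f n ℚ.* g n ∣ ℚ.<_) (*-cancel-reciprocal ε Bt≡1) (∣p*q∣<p′*q′ f< g<))
      (hf (ε ℚ.* t) (0<* 0<ε 0<t)) hg

  seq-bounded : ∀ x → Bounded (seq x)
  seq-bounded x =
    let N , h = cauchy x 1ℚ (ℚ.positive⁻¹ 1ℚ) in ℚ.∣ seq x N ∣ ℚ.+ 1ℚ
    , ℚ.+-mono-≤-< (ℚ.0≤∣p∣ (seq x N)) (ℚ.positive⁻¹ 1ℚ)
    , N , λ n N≤n → subst (λ p → ℚ.∣ p ∣ ℚ.< ℚ.∣ seq x N ∣ ℚ.+ 1ℚ)
      (solve 2 (λ p q → p :+ (q :- p) := q) refl (seq x N) (seq x n))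
      (ℚ.≤-<-trans (ℚ.∣p+q∣≤∣p∣+∣q∣ (seq x N) (seq x n ℚ.- seq x N))
        (ℚ.+-monoʳ-< ℚ.∣ seq x N ∣ (h n N N≤n ℕ.≤-refl)))

  pointwise⇒≈ᵣ : ∀ {x y} → (∀ n → seq x n ≡ seq y n) → x ≈ᵣ y
  pointwise⇒≈ᵣ {x} {y} h = mk≈ᵣ λ ε 0<ε → 0 , λ n _ →
    subst (λ p → ℚ.∣ p ∣ ℚ.< ε)
      (sym (trans (cong (ℚ._- seq y n) (h n)) (ℚ.+-inverseʳ (seq y n)))) 0<ε

  ≈ᵣ-refl : ∀ {x} → x ≈ᵣ x
  ≈ᵣ-refl {x} = pointwise⇒≈ᵣ {x} {x} λ _ → refl

  ≈ᵣ-sym : ∀ {x y} → x ≈ᵣ y → y ≈ᵣ x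
  ≈ᵣ-sym {x} {y} (mk≈ᵣ h) = mk≈ᵣ (null-cong
    (λ n → solve 2 (λ p q → :- (p :- q) := q :- p) refl (seq x n) (seq y n)) (null-neg h))

  ≈ᵣ-trans : ∀ {x y z} → x ≈ᵣ y → y ≈ᵣ z → x ≈ᵣ z
  ≈ᵣ-trans {x} {y} {z} (mk≈ᵣ h) (mk≈ᵣ k) = mk≈ᵣ (null-cong
    (λ n → solve 3 (λ p q r → (p :- q) :+ (q :- r) := p :- r) refl (seq x n) (seq y n) (seq z n))
    (null-+ h k))

  +ᵣ-cong : ∀ {x x′ y y′} → x ≈ᵣ x′ → y ≈ᵣ y′ → x +ᵣ y ≈ᵣ x′ +ᵣ y′
  +ᵣ-cong {x} {x′} {y} {y′} (mk≈ᵣ h) (mk≈ᵣ k) = mk≈ᵣ (null-cong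
    (λ n → solve 4 (λ p p′ q q′ → (p :- p′) :+ (q :- q′) := (p :+ q) :- (p′ :+ q′)) refl
      (seq x n) (seq x′ n) (seq y n) (seq y′ n))
    (null-+ h k))

  -ᵣ-cong : ∀ {x x′} → x ≈ᵣ x′ → -ᵣ x ≈ᵣ -ᵣ x′
  -ᵣ-cong {x} {x′} (mk≈ᵣ h) = mk≈ᵣ (null-cong
    (λ n → solve 2 (λ p p′ → :- (p :- p′) := (:- p) :- (:- p′)) refl (seq x n) (seq x′ n))
    (null-neg h))

  *ᵣ-cong : ∀ {x x′ y y′} → x ≈ᵣ x′ → y ≈ᵣ y′ → x *ᵣ y ≈ᵣ x′ *ᵣ y′
  *ᵣ-cong {x} {x′} {y} {y′} (mk≈ᵣ h) (mk≈ᵣ k) = mk≈ᵣ (null-cong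
    (λ n → solve 4 (λ p p′ q q′ → (p :- p′) :* q :+ (q :- q′) :* p′ := p :* q :- p′ :* q′) refl
      (seq x n) (seq x′ n) (seq y n) (seq y′ n))
    (null-+ (null-* h (seq-bounded y)) (null-* k (seq-bounded x′))))

  -- Positivity and apartness of reals

  Positive : ℝ → Set
  Positive x = ∃[ ε ] (0ℚ ℚ.< ε × Eventually (λ n → ε ℚ.< seq x n))

  positive-resp-≈ᵣ : ∀ {x y} → x ≈ᵣ y → Positive x → Positive y
  positive-resp-≈ᵣ {x} {y} (mk≈ᵣ h) (ε , 0<ε , p) = ½ ℚ.* ε , 0<½* 0<ε ,
    ev-zip (λ n ε<x x-y< → +-cancelʳ-< (½ ℚ.* ε)
        (subst (ℚ._< seq y n ℚ.+ ½ ℚ.* ε) (sym (½+½ ε)) (ℚ.<-trans ε<x (∣p-q∣<ε⇒p<q+ε x-y<))))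
      p (h (½ ℚ.* ε) (0<½* 0<ε))

  positive-1 : Positive 1ᵣ
  positive-1 = ½ , ℚ.positive⁻¹ ½ , 0 , λ _ _ → ℚ.*<* (ℤ.+<+ (ℕ.s≤s (ℕ.s≤s ℕ.z≤n)))

  ¬positive-0 : ∀ {x} → x ≈ᵣ 0ᵣ → ¬ Positive x
  ¬positive-0 {x} x≈0 px =
    let ε , 0<ε , N , h = positive-resp-≈ᵣ {x} {0ᵣ} x≈0 px
    in ℚ.<-irrefl refl (ℚ.<-trans 0<ε (h N ℕ.≤-refl))

  positive-+-nonNeg : ∀ x y → Positive x → (∀ n → 0ℚ ℚ.≤ seq y n) → Positive (x +ᵣ y)
  positive-+-nonNeg x y (ε , 0<ε , p) 0≤y = ε , 0<ε ,
    ev-map (λ n ε<x → subst (ℚ._< seq x n ℚ.+ seq y n) (ℚ.+-identityʳ ε) (ℚ.+-mono-<-≤ ε<x (0≤y n))) p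

  nonNeg-+-positive : ∀ x y → (∀ n → 0ℚ ℚ.≤ seq x n) → Positive y → Positive (x +ᵣ y)
  nonNeg-+-positive x y 0≤x p = positive-resp-≈ᵣ
    (pointwise⇒≈ᵣ {y +ᵣ x} {x +ᵣ y} λ n → ℚ.+-comm (seq y n) (seq x n)) (positive-+-nonNeg y x p 0≤x)

  -- The constructive substitute for deciding signs. One rational comparison suffices: past `K` the
  -- sequence of `x` stays within `ε/4` of its value at `K`, so `x` exceeds `ε/4` if that value is
  -- above `ε/2`; otherwise `x` stays below `3ε/4` and `y` exceeds `ε/4`.
  positive-split : ∀ x y → Positive (x +ᵣ y) → Positive x ⊎ Positive y
  positive-split x y (ε , 0<ε , M , p) =
    let N , c = cauchy x δ 0<δ
        K = M ℕ.⊔ N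
        M≤ = λ n K≤n → ℕ.m⊔n≤o⇒m≤o M N K≤n
        N≤ = λ n K≤n → ℕ.m⊔n≤o⇒n≤o M N K≤n
    in decide K (λ n K≤n → p n (M≤ n K≤n))
         (λ n K≤n → c K n (N≤ K ℕ.≤-refl) (N≤ n K≤n))
    where
    δ = ½ ℚ.* (½ ℚ.* ε)
    0<δ = 0<½* (0<½* 0<ε)
    decide : ∀ K → (∀ n → K ℕ.≤ n → ε ℚ.< seq x n ℚ.+ seq y n) →
      (∀ n → K ℕ.≤ n → ℚ.∣ seq x K ℚ.- seq x n ∣ ℚ.< δ) → Positive x ⊎ Positive y
    decide K p c with ½ ℚ.* ε ℚ.<? seq x K
    ... | yes ½ε<x = inj₁ (δ , 0<δ , K , λ n K≤n → +-cancelʳ-< δ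
      (ℚ.<-trans (subst (ℚ._< seq x K) (sym (½+½ (½ ℚ.* ε))) ½ε<x) (∣p-q∣<ε⇒p<q+ε (c n K≤n))))
    ... | no ½ε≮x = inj₂ (δ , 0<δ , K , λ n K≤n → +-cancelˡ-< (½ ℚ.* ε ℚ.+ δ)
      (ℚ.<-trans (subst (ℚ._< seq x n ℚ.+ seq y n)
          (solve 1 (λ e → e := con ½ :* e :+ con ½ :* (con ½ :* e) :+ con ½ :* (con ½ :* e)) refl ε)
          (p n K≤n))
        (ℚ.+-monoˡ-< (seq y n) (ℚ.<-≤-trans
          (∣p-q∣<ε⇒p<q+ε {seq x n} {seq x K} (subst (ℚ._< δ) (∣p-q∣≡∣q-p∣ (seq x K) (seq x n)) (c n K≤n)))
          (ℚ.+-monoˡ-≤ δ (ℚ.≮⇒≥ ½ε≮x))))))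

  #0⇒positive-square : ∀ x → x #ᵣ 0ᵣ → Positive (x *ᵣ x)
  #0⇒positive-square x (ε , 0<ε , h) = ε ℚ.* ε , 0<* 0<ε 0<ε ,
    ev-map (λ n ε<∣x-0∣ →
      let ε<∣x∣ = subst (λ p → ε ℚ.< ℚ.∣ p ∣) (ℚ.+-identityʳ (seq x n)) ε<∣x-0∣
      in subst (ε ℚ.* ε ℚ.<_) (∣p∣*∣p∣≡p*p (seq x n))
        (ℚ.<-≤-trans (ℚ.*-monoˡ-<-pos ε {{ℚ.positive 0<ε}} ε<∣x∣)
          (ℚ.*-monoˡ-≤-nonNeg ℚ.∣ seq x n ∣ {{ℚ.∣-∣-nonNeg (seq x n)}} (ℚ.<⇒≤ ε<∣x∣)))) h

  -- A Cauchy sequence is eventually bounded by some `B`, so `x² > ε` forces `|x| > ε/B`.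
  positive-square⇒#0 : ∀ x → Positive (x *ᵣ x) → x #ᵣ 0ᵣ
  positive-square⇒#0 x (ε , 0<ε , h) =
    let B , 0<B , b = seq-bounded x
        t , 0<t , Bt≡1 = reciprocal 0<B
    in ε ℚ.* t , 0<* 0<ε 0<t , ev-zip
      (λ n ε<x² x<B → subst (λ p → ε ℚ.* t ℚ.< ℚ.∣ p ∣) (sym (ℚ.+-identityʳ (seq x n)))
        (ℚ.*-cancelʳ-<-nonNeg B {{ℚ.nonNegative (ℚ.<⇒≤ 0<B)}}
          (subst (ℚ._< ℚ.∣ seq x n ∣ ℚ.* B)
            (sym (*-cancel-reciprocal ε Bt≡1))
            (ℚ.<-≤-trans ε<x² (ℚ.≤-trans (ℚ.≤-reflexive (sym (∣p∣*∣p∣≡p*p (seq x n))))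
              (ℚ.*-monoˡ-≤-nonNeg ℚ.∣ seq x n ∣ {{ℚ.∣-∣-nonNeg (seq x n)}} (ℚ.<⇒≤ x<B)))))))
      h b

  -- Reciprocal square roots

  1/suc : ∀ n → ∃[ η ] (0ℚ ℚ.< η × ι (suc n) ℚ.* η ≡ 1ℚ)
  1/suc n = reciprocal (0<ι n)

  1/suc-null : Null (λ n → proj₁ (1/suc n))
  1/suc-null ε 0<ε =
    let N , 1<Nε = archimedean 1ℚ 0<ε in N , λ n N≤n →
    let η , 0<η , nη≡1 = 1/suc n in
    subst (ℚ._< ε) (sym (ℚ.0≤p⇒∣p∣≡p (ℚ.<⇒≤ 0<η)))
      (ℚ.*-cancelˡ-<-nonNeg (ι (suc n)) {{ℚ.nonNegative (0≤ι (suc n))}}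
        (subst (ℚ._< ι (suc n) ℚ.* ε) (sym nη≡1) (ℚ.<-≤-trans 1<Nε
          (ℚ.*-monoʳ-≤-nonNeg ε {{ℚ.nonNegative (ℚ.<⇒≤ 0<ε)}}
            (ι-mono-≤ (ℕ.≤-trans N≤n (ℕ.n≤1+n n)))))))

  -- For positive numbers `|p - q| ≤ p + q`. This transfers the Cauchy property from squares to
  -- roots without a lower bound on the roots.
  ∣p-q∣²≤∣p²-q²∣ : ∀ {p q} → 0ℚ ℚ.< p → 0ℚ ℚ.< q →
    ℚ.∣ p ℚ.- q ∣ ℚ.* ℚ.∣ p ℚ.- q ∣ ℚ.≤ ℚ.∣ p ℚ.* p ℚ.- q ℚ.* q ∣
  ∣p-q∣²≤∣p²-q²∣ {p} {q} 0<p 0<q = begin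
    ℚ.∣ p ℚ.- q ∣ ℚ.* ℚ.∣ p ℚ.- q ∣
      ≤⟨ ℚ.*-monoˡ-≤-nonNeg ℚ.∣ p ℚ.- q ∣ {{ℚ.∣-∣-nonNeg (p ℚ.- q)}} (ℚ.∣p-q∣≤∣p∣+∣q∣ p q) ⟩
    ℚ.∣ p ℚ.- q ∣ ℚ.* (ℚ.∣ p ∣ ℚ.+ ℚ.∣ q ∣)
      ≡⟨ cong (ℚ.∣ p ℚ.- q ∣ ℚ.*_) (trans (cong₂ ℚ._+_ (abs 0<p) (abs 0<q)) (sym (abs (ℚ.+-mono-< 0<p 0<q)))) ⟩
    ℚ.∣ p ℚ.- q ∣ ℚ.* ℚ.∣ p ℚ.+ q ∣
      ≡⟨ sym (ℚ.∣p*q∣≡∣p∣*∣q∣ (p ℚ.- q) (p ℚ.+ q)) ⟩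
    ℚ.∣ (p ℚ.- q) ℚ.* (p ℚ.+ q) ∣
      ≡⟨ cong ℚ.∣_∣ (solve 2 (λ p q → (p :- q) :* (p :+ q) := p :* p :- q :* q) refl p q) ⟩
    ℚ.∣ p ℚ.* p ℚ.- q ℚ.* q ∣ ∎
    where
    open ℚ.≤-Reasoning
    abs : ∀ {r} → 0ℚ ℚ.< r → ℚ.∣ r ∣ ≡ r
    abs 0<r = ℚ.0≤p⇒∣p∣≡p (ℚ.<⇒≤ 0<r)

  cauchy-near : ∀ {x y} → Null (λ n → y n ℚ.- x n) → IsCauchy x → IsCauchy y
  cauchy-near {x} {y} y-x cx ε 0<ε =
    let M , h = y-x (½ ℚ.* (½ ℚ.* ε)) (0<½* (0<½* 0<ε))
        N , k = cx (½ ℚ.* ε) (0<½* 0<ε)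
    in M ℕ.⊔ N , λ m n m≥ n≥ →
      let hm = h m (ℕ.m⊔n≤o⇒m≤o M N m≥)
          hn = h n (ℕ.m⊔n≤o⇒m≤o M N n≥)
      in subst (λ p → ℚ.∣ p ∣ ℚ.< ε)
        (solve 4 (λ a b c d → ((a :- b) :+ :- (c :- d)) :+ (b :- d) := a :- c) refl
          (y m) (x m) (y n) (x n))
        (∣p+q∣<½ε+½ε
          (∣p+q∣<½ε+½ε hm (subst (ℚ._< ½ ℚ.* (½ ℚ.* ε)) (sym (ℚ.∣-p∣≡∣p∣ (y n ℚ.- x n))) hn))
          (k m n (ℕ.m⊔n≤o⇒n≤o M N m≥) (ℕ.m⊔n≤o⇒n≤o M N n≥)))

  module ReciprocalSqrt (a : ℝ) (δ : ℚ) (0<δ : 0ℚ ℚ.< δ) (δ<a : Eventually (λ n → δ ℚ.< seq a n)) where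

    -- Truncating at `δ` makes every term positive, so a root can be taken at each index; from some
    -- index on the terms agree with those of `a`.
    q : ℕ → ℚ
    q n = seq a n ℚ.⊔ δ

    0<q : ∀ n → 0ℚ ℚ.< q n
    0<q n = ℚ.<-≤-trans 0<δ (ℚ.p≤q⊔p (seq a n) δ)

    root : ∀ n → ∃[ s ] (0ℚ ℚ.< s × q n ℚ.≤ s ℚ.* s × s ℚ.* s ℚ.- q n ℚ.< proj₁ (1/suc n))
    root n = sqrt-approx (0<q n) (proj₁ (proj₂ (1/suc n)))

    s t : ℕ → ℚ
    s n = proj₁ (root n)

    0<s : ∀ n → 0ℚ ℚ.< s n
    0<s n = proj₁ (proj₂ (root n))

    q≤s² : ∀ n → q n ℚ.≤ s n ℚ.* s n
    q≤s² n = proj₁ (proj₂ (proj₂ (root n)))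

    s²-q<η : ∀ n → s n ℚ.* s n ℚ.- q n ℚ.< proj₁ (1/suc n)
    s²-q<η n = proj₂ (proj₂ (proj₂ (root n)))

    t n = proj₁ (reciprocal (0<s n))

    0<t : ∀ n → 0ℚ ℚ.< t n
    0<t n = proj₁ (proj₂ (reciprocal (0<s n)))

    s²t²≡1 : ∀ n → s n ℚ.* s n ℚ.* (t n ℚ.* t n) ≡ 1ℚ
    s²t²≡1 n = trans (solve 2 (λ s t → s :* s :* (t :* t) := s :* t :* (s :* t)) refl (s n) (t n))
      (cong (λ p → p ℚ.* p) (proj₂ (proj₂ (reciprocal (0<s n)))))

    s²-a-null : Null (λ n → s n ℚ.* s n ℚ.- seq a n)
    s²-a-null ε 0<ε = ev-zip
      (λ n η<ε δ<aₙ → let q≡a = ℚ.p≥q⇒p⊔q≡p (ℚ.<⇒≤ δ<aₙ) in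
        subst (λ p → ℚ.∣ s n ℚ.* s n ℚ.- p ∣ ℚ.< ε) q≡a
          (subst (ℚ._< ε) (sym (ℚ.0≤p⇒∣p∣≡p (0≤q-p (q≤s² n))))
            (ℚ.<-trans (ℚ.<-≤-trans (s²-q<η n) (p≤∣p∣ _)) η<ε)))
      (1/suc-null ε 0<ε) δ<a

    K : ℚ
    K = proj₁ (reciprocal 0<δ)

    0<K : 0ℚ ℚ.< K
    0<K = proj₁ (proj₂ (reciprocal 0<δ))

    t²≤K : ∀ n → t n ℚ.* t n ℚ.≤ K
    t²≤K n = ℚ.*-cancelˡ-≤-pos δ {{ℚ.positive 0<δ}}
      (subst (δ ℚ.* (t n ℚ.* t n) ℚ.≤_) (trans (s²t²≡1 n) (sym (proj₂ (proj₂ (reciprocal 0<δ)))))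
        (ℚ.*-monoʳ-≤-nonNeg (t n ℚ.* t n) {{ℚ.nonNegative (0≤p*p (t n))}}
          (ℚ.≤-trans (ℚ.p≤q⊔p (seq a n) δ) (q≤s² n))))

    t²-bounded : Bounded (λ n → t n ℚ.* t n)
    t²-bounded = K ℚ.+ K , ℚ.+-mono-< 0<K 0<K , 0 , λ n _ →
      subst (ℚ._< K ℚ.+ K) (sym (ℚ.0≤p⇒∣p∣≡p (0≤p*p (t n))))
        (ℚ.≤-<-trans (t²≤K n) (subst (ℚ._< K ℚ.+ K) (ℚ.+-identityʳ K) (ℚ.+-monoʳ-< K 0<K)))

    -- The identity `1/x - 1/y = (y - x)/(xy)` for `x = s²` and `y = s²` at the two indices.
    t²-difference : ∀ m n → t m ℚ.* t m ℚ.- t n ℚ.* t n ≡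
      (t m ℚ.* t m) ℚ.* (t n ℚ.* t n) ℚ.* (s n ℚ.* s n ℚ.- s m ℚ.* s m)
    t²-difference m n = trans
      (cong₂ ℚ._-_ (insert (t m ℚ.* t m) (s²t²≡1 n)) (insert (t n ℚ.* t n) (s²t²≡1 m)))
      (solve 4 (λ u v x y → u :* (y :* v) :- v :* (x :* u) := u :* v :* (y :- x)) refl
        (t m ℚ.* t m) (t n ℚ.* t n) (s m ℚ.* s m) (s n ℚ.* s n))
      where
      insert : ∀ p {r} → r ≡ 1ℚ → p ≡ p ℚ.* r
      insert p r≡1 = sym (trans (cong (p ℚ.*_) r≡1) (ℚ.*-identityʳ p))

    K²L²≡1 : ∀ {L} → K ℚ.* L ≡ 1ℚ → ∀ p → K ℚ.* K ℚ.* (L ℚ.* L ℚ.* p) ≡ p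
    K²L²≡1 {L} KL≡1 p = trans
      (solve 3 (λ k l p → k :* k :* (l :* l :* p) := k :* l :* (k :* l) :* p) refl K L p)
      (trans (cong (λ x → x ℚ.* x ℚ.* p) KL≡1) (solve 1 (λ p → con 1ℚ :* con 1ℚ :* p := p) refl p))

    ∣t-t∣²≤ : ∀ m n → ℚ.∣ t m ℚ.- t n ∣ ℚ.* ℚ.∣ t m ℚ.- t n ∣ ℚ.≤
      K ℚ.* K ℚ.* ℚ.∣ s n ℚ.* s n ℚ.- s m ℚ.* s m ∣
    ∣t-t∣²≤ m n = begin
      ℚ.∣ t m ℚ.- t n ∣ ℚ.* ℚ.∣ t m ℚ.- t n ∣
        ≤⟨ ∣p-q∣²≤∣p²-q²∣ (0<t m) (0<t n) ⟩
      ℚ.∣ t m ℚ.* t m ℚ.- t n ℚ.* t n ∣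
        ≡⟨ cong ℚ.∣_∣ (t²-difference m n) ⟩
      ℚ.∣ (t m ℚ.* t m) ℚ.* (t n ℚ.* t n) ℚ.* (s n ℚ.* s n ℚ.- s m ℚ.* s m) ∣
        ≡⟨ ℚ.∣p*q∣≡∣p∣*∣q∣ ((t m ℚ.* t m) ℚ.* (t n ℚ.* t n)) (s n ℚ.* s n ℚ.- s m ℚ.* s m) ⟩
      ℚ.∣ (t m ℚ.* t m) ℚ.* (t n ℚ.* t n) ∣ ℚ.* ℚ.∣ s n ℚ.* s n ℚ.- s m ℚ.* s m ∣
        ≡⟨ cong (ℚ._* ℚ.∣ s n ℚ.* s n ℚ.- s m ℚ.* s m ∣)
             (ℚ.0≤p⇒∣p∣≡p (0≤* (0≤p*p (t m)) (0≤p*p (t n)))) ⟩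
      (t m ℚ.* t m) ℚ.* (t n ℚ.* t n) ℚ.* ℚ.∣ s n ℚ.* s n ℚ.- s m ℚ.* s m ∣
        ≤⟨ ℚ.*-monoʳ-≤-nonNeg ℚ.∣ s n ℚ.* s n ℚ.- s m ℚ.* s m ∣
             {{ℚ.∣-∣-nonNeg (s n ℚ.* s n ℚ.- s m ℚ.* s m)}}
             (*-mono-≤-nonNeg (0≤p*p (t n)) (ℚ.<⇒≤ 0<K) (t²≤K m) (t²≤K n)) ⟩
      K ℚ.* K ℚ.* ℚ.∣ s n ℚ.* s n ℚ.- s m ℚ.* s m ∣ ∎
      where open ℚ.≤-Reasoning

    t-cauchy : IsCauchy t
    t-cauchy ε 0<ε =
      let L , 0<L , KL≡1 = reciprocal 0<K
          N , h = cauchy-near {seq a} {λ n → s n ℚ.* s n} s²-a-null (cauchy a)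
            -- Here `K = 1/δ` bounds `t²` and `L = 1/K`. The tolerance `L²ε²` cancels the factor
            -- `K²` of `∣t-t∣²≤` and leaves `ε²`.
            (L ℚ.* L ℚ.* (ε ℚ.* ε)) (0<* (0<* 0<L 0<L) (0<* 0<ε 0<ε))
      in N , λ m n m≥ n≥ → <-square-cancel (ℚ.<⇒≤ 0<ε)
        (ℚ.≤-<-trans (∣t-t∣²≤ m n) (subst (K ℚ.* K ℚ.* ℚ.∣ s n ℚ.* s n ℚ.- s m ℚ.* s m ∣ ℚ.<_)
          (K²L²≡1 KL≡1 (ε ℚ.* ε))
          (ℚ.*-monoʳ-<-pos (K ℚ.* K) {{ℚ.positive (0<* 0<K 0<K)}} (h n m n≥ m≥))))

    ta²≈1 : mkℝ t t-cauchy *ᵣ mkℝ t t-cauchy *ᵣ a ≈ᵣ 1ᵣ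
    ta²≈1 = mk≈ᵣ (null-cong
      (λ n → trans
        (solve 3 (λ s² t² a → :- (s² :- a) :* t² := t² :* a :- s² :* t²) refl
          (s n ℚ.* s n) (t n ℚ.* t n) (seq a n))
        (cong (λ p → t n ℚ.* t n ℚ.* seq a n ℚ.- p) (s²t²≡1 n)))
      (null-* (null-neg s²-a-null) t²-bounded))

  reciprocal-sqrt : ∀ a → Positive a → ∃[ s ] s *ᵣ s *ᵣ a ≈ᵣ 1ᵣ
  reciprocal-sqrt a (δ , 0<δ , δ<a) = _ , ReciprocalSqrt.ta²≈1 a δ 0<δ δ<a

open Reals

-- The ring of complex numbers

pointwise⇒≈ : ∀ {z w} → (∀ n → seq (re z) n ≡ seq (re w) n) →
  (∀ n → seq (im z) n ≡ seq (im w) n) → z ≈ w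
pointwise⇒≈ {z} {w} h k =
  mk≈ (pointwise⇒≈ᵣ {re z} {re w} h) (pointwise⇒≈ᵣ {im z} {im w} k)

≈-isEquivalence : IsEquivalence _≈_
≈-isEquivalence = record
  { refl  = mk≈ ≈ᵣ-refl ≈ᵣ-refl
  ; sym   = λ { (mk≈ p q) → mk≈ (≈ᵣ-sym p) (≈ᵣ-sym q) }
  ; trans = λ { (mk≈ p q) (mk≈ p′ q′) → mk≈ (≈ᵣ-trans p p′) (≈ᵣ-trans q q′) }
  }

+-cong : ∀ {z z′ w w′} → z ≈ z′ → w ≈ w′ → z + w ≈ z′ + w′
+-cong (mk≈ p q) (mk≈ p′ q′) = mk≈ (+ᵣ-cong p p′) (+ᵣ-cong q q′)

*-cong : ∀ {z z′ w w′} → z ≈ z′ → w ≈ w′ → z * w ≈ z′ * w′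
*-cong (mk≈ p q) (mk≈ p′ q′) = mk≈
  (+ᵣ-cong (*ᵣ-cong p p′) (-ᵣ-cong (*ᵣ-cong q q′)))
  (+ᵣ-cong (*ᵣ-cong p q′) (*ᵣ-cong q p′))

-‿cong : ∀ {z z′} → z ≈ z′ → - z ≈ - z′
-‿cong (mk≈ p q) = mk≈ (-ᵣ-cong p) (-ᵣ-cong q)

conj-cong : ∀ {z z′} → z ≈ z′ → conj z ≈ conj z′
conj-cong (mk≈ p q) = mk≈ p (-ᵣ-cong q)

module _ where
  open +-*-Solver using (solve; _:+_; _:*_; _:-_; :-_; _:=_; con)

  *-assoc : ∀ x y z → (x * y) * z ≈ x * (y * z)
  *-assoc (a +i b) (c +i d) (e +i f) = pointwise⇒≈
    (λ n → solve 6 (λ a b c d e f →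
        (a :* c :+ :- (b :* d)) :* e :+ :- ((a :* d :+ b :* c) :* f) :=
        a :* (c :* e :+ :- (d :* f)) :+ :- (b :* (c :* f :+ d :* e))) refl
      (seq a n) (seq b n) (seq c n) (seq d n) (seq e n) (seq f n))
    (λ n → solve 6 (λ a b c d e f →
        (a :* c :+ :- (b :* d)) :* f :+ (a :* d :+ b :* c) :* e :=
        a :* (c :* f :+ d :* e) :+ b :* (c :* e :+ :- (d :* f))) refl
      (seq a n) (seq b n) (seq c n) (seq d n) (seq e n) (seq f n))

  *-comm : ∀ x y → x * y ≈ y * x
  *-comm (a +i b) (c +i d) = pointwise⇒≈
    (λ n → solve 4 (λ a b c d → a :* c :+ :- (b :* d) := c :* a :+ :- (d :* b)) refl
      (seq a n) (seq b n) (seq c n) (seq d n))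
    (λ n → solve 4 (λ a b c d → a :* d :+ b :* c := c :* b :+ d :* a) refl
      (seq a n) (seq b n) (seq c n) (seq d n))

  *-distribʳ-+ : ∀ x y z → (y + z) * x ≈ y * x + z * x
  *-distribʳ-+ (a +i b) (c +i d) (e +i f) = pointwise⇒≈
    (λ n → solve 6 (λ a b c d e f →
        (c :+ e) :* a :+ :- ((d :+ f) :* b) :=
        (c :* a :+ :- (d :* b)) :+ (e :* a :+ :- (f :* b))) refl
      (seq a n) (seq b n) (seq c n) (seq d n) (seq e n) (seq f n))
    (λ n → solve 6 (λ a b c d e f →
        (c :+ e) :* b :+ (d :+ f) :* a :=
        (c :* b :+ d :* a) :+ (e :* b :+ f :* a)) refl
      (seq a n) (seq b n) (seq c n) (seq d n) (seq e n) (seq f n))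

  *-identityˡ : ∀ x → 1# * x ≈ x
  *-identityˡ (a +i b) = pointwise⇒≈
    (λ n → solve 2 (λ a b → con 1ℚ :* a :+ :- (con 0ℚ :* b) := a) refl (seq a n) (seq b n))
    (λ n → solve 2 (λ a b → con 1ℚ :* b :+ con 0ℚ :* a := b) refl (seq a n) (seq b n))

  conj-* : ∀ x y → conj (x * y) ≈ conj x * conj y
  conj-* (a +i b) (c +i d) = pointwise⇒≈
    (λ n → solve 4 (λ a b c d → a :* c :+ :- (b :* d) := a :* c :+ :- ((:- b) :* (:- d))) refl
      (seq a n) (seq b n) (seq c n) (seq d n))
    (λ n → solve 4 (λ a b c d → :- (a :* d :+ b :* c) := a :* (:- d) :+ (:- b) :* c) refl
      (seq a n) (seq b n) (seq c n) (seq d n))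

  conj-*-self : ∀ x → conj x * x ≈ (re x *ᵣ re x +ᵣ im x *ᵣ im x) +i 0ᵣ
  conj-*-self (a +i b) = pointwise⇒≈
    (λ n → solve 2 (λ a b → a :* a :+ :- ((:- b) :* b) := a :* a :+ b :* b) refl (seq a n) (seq b n))
    (λ n → solve 2 (λ a b → a :* b :+ (:- b) :* a := con 0ℚ) refl (seq a n) (seq b n))

  real-square-* : ∀ s a → (s +i 0ᵣ) * (s +i 0ᵣ) * (a +i 0ᵣ) ≈ (s *ᵣ s *ᵣ a) +i 0ᵣ
  real-square-* s a = pointwise⇒≈
    (λ n → solve 2 (λ s a →
        (s :* s :+ :- (con 0ℚ :* con 0ℚ)) :* a :+ :- ((s :* con 0ℚ :+ con 0ℚ :* s) :* con 0ℚ) :=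
        s :* s :* a) refl (seq s n) (seq a n))
    (λ n → solve 2 (λ s a →
        (s :* s :+ :- (con 0ℚ :* con 0ℚ)) :* con 0ℚ :+ (s :* con 0ℚ :+ con 0ℚ :* s) :* a :=
        con 0ℚ) refl (seq s n) (seq a n))

conj-+ : ∀ x y → conj (x + y) ≈ conj x + conj y
conj-+ (a +i b) (c +i d) = pointwise⇒≈ (λ n → refl)
  (λ n → ℚ.neg-distrib-+ (seq b n) (seq d n))

conj-involutive : ∀ x → conj (conj x) ≈ x
conj-involutive (a +i b) = pointwise⇒≈ (λ n → refl)
  (λ n → ℚ-neg-involutive (seq b n))
  where
  open AbelianGroupProperties ℚ.+-0-abelianGroup
    using () renaming (⁻¹-involutive to ℚ-neg-involutive)

conj-0 : conj 0# ≈ 0#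
conj-0 = pointwise⇒≈ (λ n → refl) (λ n → refl)

conj-1 : conj 1# ≈ 1#
conj-1 = pointwise⇒≈ (λ n → refl) (λ n → refl)

conj-neg : ∀ x → conj (- x) ≈ - conj x
conj-neg x = pointwise⇒≈ (λ n → refl) (λ n → refl)

ℂ-commutativeRing : CommutativeRing 0ℓ 0ℓ
ℂ-commutativeRing = record
  { Carrier = ℂ ; _≈_ = _≈_ ; _+_ = _+_ ; _*_ = _*_ ; -_ = -_ ; 0# = 0# ; 1# = 1#
  ; isCommutativeRing = record
    { isRing = record
      { +-isAbelianGroup = record
        { isGroup = record
          { isMonoid = record
            { isSemigroup = record
              { isMagma = record { isEquivalence = ≈-isEquivalence ; ∙-cong = +-cong }
              ; assoc = λ x y z → pointwise⇒≈
                  (λ n → ℚ.+-assoc (seq (re x) n) (seq (re y) n) (seq (re z) n))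
                  (λ n → ℚ.+-assoc (seq (im x) n) (seq (im y) n) (seq (im z) n))
              }
            ; identity =
                (λ x → pointwise⇒≈ (λ n → ℚ.+-identityˡ (seq (re x) n)) (λ n → ℚ.+-identityˡ (seq (im x) n)))
              , (λ x → pointwise⇒≈ (λ n → ℚ.+-identityʳ (seq (re x) n)) (λ n → ℚ.+-identityʳ (seq (im x) n)))
            }
          ; inverse =
              (λ x → pointwise⇒≈ (λ n → ℚ.+-inverseˡ (seq (re x) n)) (λ n → ℚ.+-inverseˡ (seq (im x) n)))
            , (λ x → pointwise⇒≈ (λ n → ℚ.+-inverseʳ (seq (re x) n)) (λ n → ℚ.+-inverseʳ (seq (im x) n)))
          ; ⁻¹-cong = -‿cong
          }
        ; comm = λ x y → pointwise⇒≈
            (λ n → ℚ.+-comm (seq (re x) n) (seq (re y) n)) (λ n → ℚ.+-comm (seq (im x) n) (seq (im y) n))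
        }
      ; *-cong = *-cong
      ; *-assoc = *-assoc
      ; *-identity = *-identityˡ , λ x → ≈-trans (*-comm x 1#) (*-identityˡ x)
      ; distrib = (λ x y z → ≈-trans (*-comm x (y + z))
            (≈-trans (*-distribʳ-+ x y z) (+-cong (*-comm y x) (*-comm z x))))
          , *-distribʳ-+
      }
    ; *-comm = *-comm
    }
  }
  where open IsEquivalence ≈-isEquivalence using () renaming (trans to ≈-trans)

open CommutativeRing ℂ-commutativeRing
  using (+-identityˡ; +-identityʳ; zeroˡ; zeroʳ; *-identityʳ)
  renaming ( refl to ≈-refl; sym to ≈-sym; trans to ≈-trans; reflexive to ≈-reflexive
           ; setoid to ℂ-setoid; semiring to ℂ-semiring
           ; +-commutativeMonoid to ℂ-+-commutativeMonoid )

rational : ℚ → ℂ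
rational q = mkℝ (λ _ → q) (const-cauchy q) +i 0ᵣ

-- Supplies rational coefficients to the ring solver: their equality is decidable, so normal forms
-- can be compared although `_≈_` on `ℂ` cannot be decided.
rational-morphism : ℚ.+-*-rawRing -Raw-AlmostCommutative⟶ fromCommutativeRing ℂ-commutativeRing
rational-morphism = record
  { ⟦_⟧    = rational
  ; +-homo = λ p q → pointwise⇒≈ (λ n → refl) (λ n → refl)
  ; *-homo = λ p q → pointwise⇒≈
      (λ n → sym (ℚ.+-identityʳ (p ℚ.* q)))
      (λ n → sym (cong₂ ℚ._+_ (ℚ.*-zeroʳ p) (ℚ.*-zeroˡ q)))
  ; -‿homo = λ p → pointwise⇒≈ (λ n → refl) (λ n → refl)
  ; 0-homo = ≈-refl
  ; 1-homo = ≈-refl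
  }

rational-≟ : WeaklyDecidable (Induced-equivalence rational-morphism)
rational-≟ p q = Maybe.map (λ p≡q → ≈-reflexive (cong rational p≡q)) (dec⇒weaklyDec ℚ._≟_ p q)

module ℂ-Solver = RingSolver ℚ.+-*-rawRing (fromCommutativeRing ℂ-commutativeRing)
  rational-morphism rational-≟

open CommutativeMonoidSum ℂ-+-commutativeMonoid using (sum-cong-≋; ∑-distrib-+)
open SemiringSum ℂ-semiring using (*-distribˡ-sum; *-distribʳ-sum)
open SetoidReasoning ℂ-setoid
open ℂ-Solver using (solve; _:+_; _:*_; _:-_; :-_; _:=_; con)

-- Inner products and norms

conj-sum : ∀ {n} (f : Vector ℂ n) → conj (sum f) ≈ sum (conj ∘ f)
conj-sum {zero}  f = conj-0
conj-sum {suc n} f = ≈-trans (conj-+ (f zero) (sum (f ∘ suc))) (+-cong ≈-refl (conj-sum (f ∘ suc)))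

module _ {d : ℕ} where

  ⟨⟩-cong : ∀ {v v′ w w′ : ℂ^ d} → v ≈ᵥ v′ → w ≈ᵥ w′ → ⟨ v , w ⟩ ≈ ⟨ v′ , w′ ⟩
  ⟨⟩-cong v≈v′ w≈w′ = sum-cong-≋ λ i → *-cong (conj-cong (v≈v′ i)) (w≈w′ i)

  ⟨⟩-conj : ∀ (v w : ℂ^ d) → ⟨ v , w ⟩ ≈ conj ⟨ w , v ⟩
  ⟨⟩-conj v w = ≈-sym (≈-trans (conj-sum (λ i → conj (w i) * v i)) (sum-cong-≋ λ i →
    ≈-trans (conj-* (conj (w i)) (v i))
      (≈-trans (*-cong (conj-involutive (w i)) ≈-refl) (*-comm (w i) (conj (v i))))))

  ⟨⟩-+ʳ : ∀ (v w w′ : ℂ^ d) → ⟨ v , w +ᵥ w′ ⟩ ≈ ⟨ v , w ⟩ + ⟨ v , w′ ⟩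
  ⟨⟩-+ʳ v w w′ = ≈-trans
    (sum-cong-≋ λ i → solve 3 (λ a b c → a :* (b :+ c) := a :* b :+ a :* c) ≈-refl (conj (v i)) (w i) (w′ i))
    (∑-distrib-+ (λ i → conj (v i) * w i) (λ i → conj (v i) * w′ i))

  ⟨⟩-*ʳ : ∀ c (v w : ℂ^ d) → ⟨ v , c *ᵥ w ⟩ ≈ c * ⟨ v , w ⟩
  ⟨⟩-*ʳ c v w = ≈-trans
    (sum-cong-≋ λ i → solve 3 (λ a b c → a :* (c :* b) := c :* (a :* b)) ≈-refl (conj (v i)) (w i) c)
    (≈-sym (*-distribˡ-sum c (λ i → conj (v i) * w i)))

  ⟨⟩-+ˡ : ∀ (v v′ w : ℂ^ d) → ⟨ v +ᵥ v′ , w ⟩ ≈ ⟨ v , w ⟩ + ⟨ v′ , w ⟩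
  ⟨⟩-+ˡ v v′ w = begin
    ⟨ v +ᵥ v′ , w ⟩                 ≈⟨ ⟨⟩-conj (v +ᵥ v′) w ⟩
    conj ⟨ w , v +ᵥ v′ ⟩            ≈⟨ conj-cong (⟨⟩-+ʳ w v v′) ⟩
    conj (⟨ w , v ⟩ + ⟨ w , v′ ⟩)   ≈⟨ conj-+ ⟨ w , v ⟩ ⟨ w , v′ ⟩ ⟩
    conj ⟨ w , v ⟩ + conj ⟨ w , v′ ⟩ ≈⟨ +-cong (⟨⟩-conj v w) (⟨⟩-conj v′ w) ⟨
    ⟨ v , w ⟩ + ⟨ v′ , w ⟩          ∎

  ⟨⟩-*ˡ : ∀ c (v w : ℂ^ d) → ⟨ c *ᵥ v , w ⟩ ≈ conj c * ⟨ v , w ⟩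
  ⟨⟩-*ˡ c v w = begin
    ⟨ c *ᵥ v , w ⟩         ≈⟨ ⟨⟩-conj (c *ᵥ v) w ⟩
    conj ⟨ w , c *ᵥ v ⟩    ≈⟨ conj-cong (⟨⟩-*ʳ c w v) ⟩
    conj (c * ⟨ w , v ⟩)   ≈⟨ conj-* c ⟨ w , v ⟩ ⟩
    conj c * conj ⟨ w , v ⟩ ≈⟨ *-cong ≈-refl (⟨⟩-conj v w) ⟨
    conj c * ⟨ v , w ⟩     ∎

  ⟨⟩-scaleˡ≈0 : ∀ c {v w : ℂ^ d} → ⟨ v , w ⟩ ≈ 0# → ⟨ c *ᵥ v , w ⟩ ≈ 0#
  ⟨⟩-scaleˡ≈0 c {v} {w} v⊥w =
    ≈-trans (⟨⟩-*ˡ c v w) (≈-trans (*-cong ≈-refl v⊥w) (zeroʳ (conj c)))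

  ⟨⟩-scaleʳ≈0 : ∀ c {v w : ℂ^ d} → ⟨ v , w ⟩ ≈ 0# → ⟨ v , c *ᵥ w ⟩ ≈ 0#
  ⟨⟩-scaleʳ≈0 c {v} {w} v⊥w =
    ≈-trans (⟨⟩-*ʳ c v w) (≈-trans (*-cong ≈-refl v⊥w) (zeroʳ c))

abs² : ℂ → ℝ
abs² z = re z *ᵣ re z +ᵣ im z *ᵣ im z

square-nonNeg : ∀ x n → 0ℚ ℚ.≤ seq (x *ᵣ x) n
square-nonNeg x n = 0≤p*p (seq x n)

#0⇒positive-abs² : ∀ z → z # 0# → Positive (abs² z)
#0⇒positive-abs² z (inj₁ re#0) =
  positive-+-nonNeg (re z *ᵣ re z) (im z *ᵣ im z) (#0⇒positive-square (re z) re#0) (square-nonNeg (im z))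
#0⇒positive-abs² z (inj₂ im#0) =
  nonNeg-+-positive (re z *ᵣ re z) (im z *ᵣ im z) (square-nonNeg (re z)) (#0⇒positive-square (im z) im#0)

positive-abs²⇒#0 : ∀ z → Positive (abs² z) → z # 0#
positive-abs²⇒#0 z p = Sum.map (positive-square⇒#0 (re z)) (positive-square⇒#0 (im z))
  (positive-split (re z *ᵣ re z) (im z *ᵣ im z) p)

norm² : ∀ {d} → ℂ^ d → ℝ
norm² {zero}  v = 0ᵣ
norm² {suc d} v = abs² (v zero) +ᵣ norm² (tail v)

⟨v,v⟩≈norm² : ∀ {d} (v : ℂ^ d) → ⟨ v , v ⟩ ≈ norm² v +i 0ᵣ
⟨v,v⟩≈norm² {zero}  v = ≈-refl
⟨v,v⟩≈norm² {suc d} v = ≈-trans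
  (+-cong (conj-*-self (v zero)) (⟨v,v⟩≈norm² (tail v)))
  (pointwise⇒≈ (λ n → refl) (λ n → refl))

norm²-nonNeg : ∀ {d} (v : ℂ^ d) n → 0ℚ ℚ.≤ seq (norm² v) n
norm²-nonNeg {zero}  v n = ℚ.≤-refl
norm²-nonNeg {suc d} v n = ℚ.+-mono-≤
  (ℚ.+-mono-≤ (square-nonNeg (re (v zero)) n) (square-nonNeg (im (v zero)) n))
  (norm²-nonNeg (tail v) n)

Nonzero : ∀ {d} → ℂ^ d → Set
Nonzero v = ∃[ i ] v i # 0#

nonzero⇒positive-norm² : ∀ {d} (v : ℂ^ d) → Nonzero v → Positive (norm² v)
nonzero⇒positive-norm² v (zero , v₀#0) =
  positive-+-nonNeg (abs² (v zero)) (norm² (tail v)) (#0⇒positive-abs² (v zero) v₀#0) (norm²-nonNeg (tail v))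
nonzero⇒positive-norm² v (suc i , vᵢ#0) =
  nonNeg-+-positive (abs² (v zero)) (norm² (tail v))
    (λ n → ℚ.+-mono-≤ (square-nonNeg (re (v zero)) n) (square-nonNeg (im (v zero)) n))
    (nonzero⇒positive-norm² (tail v) (i , vᵢ#0))

-- Splitting the positive sum repeatedly locates a coordinate apart from zero, with no search over
-- undecidable statements.
positive-norm²⇒nonzero : ∀ {d} (v : ℂ^ d) → Positive (norm² v) → Nonzero v
positive-norm²⇒nonzero {zero}  v p = contradiction p (¬positive-0 ≈ᵣ-refl)
positive-norm²⇒nonzero {suc d} v p =
  [ (λ q → zero , positive-abs²⇒#0 (v zero) q)
  , (λ q → let i , vᵢ#0 = positive-norm²⇒nonzero (tail v) q in suc i , vᵢ#0)
  ]′ (positive-split (abs² (v zero)) (norm² (tail v)) p)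

-- Being nonzero depends on the norm alone, although `Nonzero` names a coordinate. This is how
-- apartness passes along `_≈ᵥ_` and through isometries, where the witnessing coordinate may change.
nonzero-resp-⟨⟩ : ∀ {m n} {v : ℂ^ m} {w : ℂ^ n} → ⟨ v , v ⟩ ≈ ⟨ w , w ⟩ → Nonzero v → Nonzero w
nonzero-resp-⟨⟩ {v = v} {w} h p = positive-norm²⇒nonzero w
  (positive-resp-≈ᵣ (_≈_.re-≈ (≈-trans (≈-sym (⟨v,v⟩≈norm² v)) (≈-trans h (⟨v,v⟩≈norm² w))))
    (nonzero⇒positive-norm² v p))

nonzero-resp-≈ᵥ : ∀ {d} {v w : ℂ^ d} → v ≈ᵥ w → Nonzero v → Nonzero w
nonzero-resp-≈ᵥ {v = v} {w} v≈w = nonzero-resp-⟨⟩ {v = v} {w} (⟨⟩-cong v≈w v≈w)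

1#0 : 1# # 0#
1#0 = inj₁ (positive-square⇒#0 1ᵣ (positive-resp-≈ᵣ {1ᵣ} {1ᵣ *ᵣ 1ᵣ} (pointwise⇒≈ᵣ {1ᵣ} {1ᵣ *ᵣ 1ᵣ} λ n → refl) positive-1))

ℂ-reciprocal-sqrt : ∀ a → Positive a → ∃[ c ] (conj c ≈ c × c * c * (a +i 0ᵣ) ≈ 1#)
ℂ-reciprocal-sqrt a a>0 =
  let s , s²a≈1 = reciprocal-sqrt a a>0
  in s +i 0ᵣ , pointwise⇒≈ (λ n → refl) (λ n → refl) ,
     ≈-trans (real-square-* s a) (mk≈ s²a≈1 ≈ᵣ-refl)

ℂ-reciprocal : ∀ α → Positive (re α) → ∃[ β ] β * α ≈ 1#
ℂ-reciprocal α re>0 =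
  let c , _ , c²a≈1 = ℂ-reciprocal-sqrt (abs² α) (#0⇒positive-abs² α (inj₁ re#0))
  -- The usual inverse `conj α / |α|²`, with `c²` in place of `1/|α|²`.
  in c * c * conj α , ≈-trans (*-assoc (c * c) (conj α) α)
       (≈-trans (*-cong ≈-refl (conj-*-self α)) c²a≈1)
  where
  re#0 : re α #ᵣ 0ᵣ
  re#0 = let ε , 0<ε , h = re>0 in ε , 0<ε , ev-map (λ n ε<x →
    subst (λ p → ε ℚ.< ℚ.∣ p ∣) (sym (ℚ.+-identityʳ (seq (re α) n)))
      (ℚ.<-≤-trans ε<x (p≤∣p∣ (seq (re α) n)))) h

record Normalisation {d} (v : ℂ^ d) : Set where
  field
    factor inverse : ℂ
  direction : ℂ^ d
  direction = factor *ᵥ v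
  field
    unit    : ⟨ direction , direction ⟩ ≈ 1#
    recover : v ≈ᵥ inverse *ᵥ direction

abstract
  normalise : ∀ {d} (v : ℂ^ d) → Nonzero v → Normalisation v
  normalise v v#0 =
    let c , c̄≈c , c²a≈1 = ℂ-reciprocal-sqrt (norm² v) (nonzero⇒positive-norm² v v#0)
        a = norm² v +i 0ᵣ
    in record
      { factor  = c
      -- From `c²a = 1`, the scalar `c * a` is the inverse of `c`.
      ; inverse = c * a
      ; unit    = begin
          ⟨ c *ᵥ v , c *ᵥ v ⟩        ≈⟨ ⟨⟩-*ˡ c v (c *ᵥ v) ⟩
          conj c * ⟨ v , c *ᵥ v ⟩    ≈⟨ *-cong c̄≈c (≈-trans (⟨⟩-*ʳ c v v) (*-cong ≈-refl (⟨v,v⟩≈norm² v))) ⟩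
          c * (c * a)                ≈⟨ *-assoc c c a ⟨
          c * c * a                  ≈⟨ c²a≈1 ⟩
          1#                         ∎
      ; recover = λ i → ≈-sym (begin
          c * a * (c * v i)          ≈⟨ solve 3 (λ a c x → c :* a :* (c :* x) := c :* c :* a :* x) ≈-refl a c (v i) ⟩
          c * c * a * v i            ≈⟨ *-cong c²a≈1 ≈-refl ⟩
          1# * v i                   ≈⟨ *-identityˡ (v i) ⟩
          v i                        ∎)
      }

-- Isometries

-- Source and target dimensions may differ, so that padding by zero coordinates and unitary maps
-- share one theory of images.
record Isometry (m n : ℕ) : Set where
  field
    ⟦_⟧       : ℂ^ m → ℂ^ n
    ⟦⟧-cong   : ∀ {v w} → v ≈ᵥ w → ⟦ v ⟧ ≈ᵥ ⟦ w ⟧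
    +-homo    : ∀ v w → ⟦ v +ᵥ w ⟧ ≈ᵥ ⟦ v ⟧ +ᵥ ⟦ w ⟧
    *-homo    : ∀ c v → ⟦ c *ᵥ v ⟧ ≈ᵥ c *ᵥ ⟦ v ⟧
    preserves : ∀ v w → ⟨ ⟦ v ⟧ , ⟦ w ⟧ ⟩ ≈ ⟨ v , w ⟩

open Isometry

id-isometry : ∀ {d} → Isometry d d
id-isometry = record
  { ⟦_⟧ = λ v → v ; ⟦⟧-cong = λ h → h
  ; +-homo = λ v w i → ≈-refl ; *-homo = λ c v i → ≈-refl ; preserves = λ v w → ≈-refl }

infixr 9 _∘ᵢ_

_∘ᵢ_ : ∀ {l m n} → Isometry m n → Isometry l m → Isometry l n
U ∘ᵢ W = record
  { ⟦_⟧       = λ v → ⟦ U ⟧ (⟦ W ⟧ v)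
  ; ⟦⟧-cong   = λ h → ⟦⟧-cong U (⟦⟧-cong W h)
  ; +-homo    = λ v w i → ≈-trans (⟦⟧-cong U (+-homo W v w) i) (+-homo U (⟦ W ⟧ v) (⟦ W ⟧ w) i)
  ; *-homo    = λ c v i → ≈-trans (⟦⟧-cong U (*-homo W c v) i) (*-homo U c (⟦ W ⟧ v) i)
  ; preserves = λ v w → ≈-trans (preserves U (⟦ W ⟧ v) (⟦ W ⟧ w)) (preserves W v w)
  }

cons-0 : ∀ {n} → Isometry n (suc n)
cons-0 = record
  { ⟦_⟧       = 0# ∷_
  ; ⟦⟧-cong   = λ { h zero → ≈-refl ; h (suc i) → h i }
  ; +-homo    = λ { v w zero → ≈-sym (+-identityˡ 0#) ; v w (suc i) → ≈-refl }
  ; *-homo    = λ { c v zero → ≈-sym (zeroʳ c) ; c v (suc i) → ≈-refl }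
  ; preserves = λ v w → ≈-trans (+-cong (zeroʳ (conj 0#)) ≈-refl) (+-identityˡ ⟨ v , w ⟩)
  }

padding : ∀ {m n} → m ℕ.≤′ n → Isometry m n
padding (ℕ.≤′-reflexive refl) = id-isometry
padding (ℕ.≤′-step m≤n)       = cons-0 ∘ᵢ padding m≤n

⟦⟧-combination : ∀ {m n} (U : Isometry m n) {r} (c : Vector ℂ r) (b : Vector (ℂ^ m) r) →
  ⟦ U ⟧ (combination c b) ≈ᵥ combination c (⟦ U ⟧ ∘ b)
⟦⟧-combination U {zero}  c b i = begin
  ⟦ U ⟧ 0ᵥ i          ≈⟨ ⟦⟧-cong U (λ j → ≈-sym (zeroˡ 0#)) i ⟩
  ⟦ U ⟧ (0# *ᵥ 0ᵥ) i  ≈⟨ *-homo U 0# 0ᵥ i ⟩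
  0# * ⟦ U ⟧ 0ᵥ i     ≈⟨ zeroˡ _ ⟩
  0#                  ∎
⟦⟧-combination U {suc r} c b i = ≈-trans
  (+-homo U (c zero *ᵥ b zero) (combination (tail c) (tail b)) i)
  (+-cong (*-homo U (c zero) (b zero) i) (⟦⟧-combination U (tail c) (tail b) i))

image : ∀ {m n} → Isometry m n → Subspace m → Subspace n
image U S = record
  { Member   = λ w → ∃[ v ] (Member S v × w ≈ᵥ ⟦ U ⟧ v)
  ; resp-≈   = λ { w≈w′ (v , v∈S , w≈Uv) → v , v∈S , λ i → ≈-trans (≈-sym (w≈w′ i)) (w≈Uv i) }
  ; 0-closed = 0ᵥ , 0-closed S , λ i → ≈-sym (⟦⟧-combination U {0} (λ ()) (λ ()) i)
  ; +-closed = λ { (v , v∈S , p) (v′ , v′∈S , p′) → v +ᵥ v′ , +-closed S v∈S v′∈S ,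
                   λ i → ≈-trans (+-cong (p i) (p′ i)) (≈-sym (+-homo U v v′ i)) }
  ; *-closed = λ { c (v , v∈S , p) → c *ᵥ v , *-closed S c v∈S ,
                   λ i → ≈-trans (*-cong ≈-refl (p i)) (≈-sym (*-homo U c v i)) }
  }

image-∘ : ∀ {l m n} (U : Isometry m n) (W : Isometry l m) (S : Subspace l) {w} →
  Member (image U (image W S)) w → Member (image (U ∘ᵢ W) S) w
image-∘ U W S (v , (u , u∈S , v≈Wu) , w≈Uv) =
  u , u∈S , λ i → ≈-trans (w≈Uv i) (⟦⟧-cong U v≈Wu i)

-- `U` preserves the norm of every combination, hence its apartness from zero.
image-independent : ∀ {m n} (U : Isometry m n) {r} (b : Vector (ℂ^ m) r) →
  LinearlyIndependent b → LinearlyIndependent (⟦ U ⟧ ∘ b)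
image-independent U b ind c c#0 = nonzero-resp-≈ᵥ (⟦⟧-combination U c b)
  (nonzero-resp-⟨⟩ {v = combination c b} {⟦ U ⟧ (combination c b)}
    (≈-sym (preserves U (combination c b) (combination c b))) (ind c c#0))

image-dimension : ∀ {m n} (U : Isometry m n) {S r} → HasDimension S r → HasDimension (image U S) r
image-dimension U (b , basis) = ⟦ U ⟧ ∘ b , record
  { members     = λ j → b j , IsBasis.members basis j , λ i → ≈-refl
  ; independent = image-independent U b (IsBasis.independent basis)
  ; spanning    = λ { (v , v∈S , w≈Uv) →
      let c , v≈cb = IsBasis.spanning basis v∈S
      in c , λ i → ≈-trans (w≈Uv i) (≈-trans (⟦⟧-cong U v≈cb i) (⟦⟧-combination U c b i)) }
  }

image-⊥ : ∀ {m n} (U : Isometry m n) {S T} → S ⊥ T → image U S ⊥ image U T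
image-⊥ U S⊥T (v , v∈S , p) (w , w∈T , q) =
  ≈-trans (⟨⟩-cong p q) (≈-trans (preserves U v w) (S⊥T v∈S w∈T))

-- H v = v − ⟨z,v⟩ z / α is unitary because ⟨z,z⟩ = α + conj α.  Unlike a
-- reflection, it can map f to e, with z = f − e, when ⟨e,f⟩ is not real.

module Householder {d} (z : ℂ^ d) (α β : ℂ)
  (⟨z,z⟩ : ⟨ z , z ⟩ ≈ α + conj α) (βα≈1 : β * α ≈ 1#) where

  coefficient : ℂ^ d → ℂ
  coefficient v = - (β * ⟨ z , v ⟩)

  H : ℂ^ d → ℂ^ d
  H v = v +ᵥ coefficient v *ᵥ z

  H-preserves : ∀ v w → ⟨ H v , H w ⟩ ≈ ⟨ v , w ⟩
  H-preserves v w = begin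
    ⟨ H v , H w ⟩
      ≈⟨ ⟨⟩-+ˡ v (x *ᵥ z) (H w) ⟩
    ⟨ v , H w ⟩ + ⟨ x *ᵥ z , H w ⟩
      ≈⟨ +-cong (expand v) (≈-trans (⟨⟩-*ˡ x z (H w)) (*-cong x̄ (expand z))) ⟩
    (m + y * ⟨ v , z ⟩) + (- (β̄ * p̄)) * (q + y * ⟨ z , z ⟩)
      ≈⟨ +-cong (+-cong ≈-refl (*-cong ≈-refl (⟨⟩-conj v z)))
           (*-cong ≈-refl (+-cong ≈-refl (*-cong ≈-refl ⟨z,z⟩))) ⟩
    (m + y * p̄) + (- (β̄ * p̄)) * (q + y * (α + conj α))
      -- Everything beyond `m` collects into one bracket that cancels once `βα` and its conjugate
      -- become 1. The hypothesis on `⟨ z , z ⟩` is chosen to produce exactly this bracket.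
      ≈⟨ solve 7 (λ m β β̄ p̄ q α ᾱ →
           (m :+ (:- (β :* q)) :* p̄) :+ (:- (β̄ :* p̄)) :* (q :+ (:- (β :* q)) :* (α :+ ᾱ)) :=
           m :+ p̄ :* q :* (β̄ :* (β :* α) :+ β :* (β̄ :* ᾱ) :- β :- β̄)) ≈-refl
           m β β̄ p̄ q α (conj α) ⟩
    m + p̄ * q * (β̄ * (β * α) + β * (β̄ * conj α) + - β + - β̄)
      ≈⟨ +-cong ≈-refl (*-cong ≈-refl (+-cong (+-cong
           (+-cong (*-cong ≈-refl βα≈1) (*-cong ≈-refl βα≈1‾)) ≈-refl) ≈-refl)) ⟩
    m + p̄ * q * (β̄ * 1# + β * 1# + - β + - β̄)
      ≈⟨ solve 5 (λ m β β̄ p̄ q → m :+ p̄ :* q :* (β̄ :* con 1ℚ :+ β :* con 1ℚ :- β :- β̄) := m) ≈-refl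
           m β β̄ p̄ q ⟩
    m ∎
    where
    m q p̄ x y β̄ : ℂ
    m = ⟨ v , w ⟩
    q = ⟨ z , w ⟩
    p̄ = conj ⟨ z , v ⟩
    x = coefficient v
    y = coefficient w
    β̄ = conj β
    expand : ∀ u → ⟨ u , H w ⟩ ≈ ⟨ u , w ⟩ + y * ⟨ u , z ⟩
    expand u = ≈-trans (⟨⟩-+ʳ u w (y *ᵥ z)) (+-cong ≈-refl (⟨⟩-*ʳ y u z))
    x̄ : conj x ≈ - (β̄ * p̄)
    x̄ = ≈-trans (conj-neg (β * ⟨ z , v ⟩)) (-‿cong (conj-* β ⟨ z , v ⟩))
    βα≈1‾ : β̄ * conj α ≈ 1#
    βα≈1‾ = ≈-trans (≈-sym (conj-* β α)) (≈-trans (conj-cong βα≈1) conj-1)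

  isometry : Isometry d d
  isometry = record
    { ⟦_⟧       = H
    ; ⟦⟧-cong   = λ {v} {w} v≈w i → +-cong (v≈w i)
        (*-cong (-‿cong (*-cong ≈-refl (⟨⟩-cong {v = z} (λ _ → ≈-refl) v≈w))) ≈-refl)
    ; +-homo    = λ v w i → ≈-trans
        (+-cong ≈-refl (*-cong (-‿cong (*-cong ≈-refl (⟨⟩-+ʳ z v w))) ≈-refl))
        (solve 6 (λ a b β p q z → (a :+ b) :+ (:- (β :* (p :+ q))) :* z :=
            (a :+ (:- (β :* p)) :* z) :+ (b :+ (:- (β :* q)) :* z)) ≈-refl
          (v i) (w i) β ⟨ z , v ⟩ ⟨ z , w ⟩ (z i))
    ; *-homo    = λ c v i → ≈-trans
        (+-cong ≈-refl (*-cong (-‿cong (*-cong ≈-refl (⟨⟩-*ʳ c z v))) ≈-refl))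
        (solve 5 (λ c a β p z → c :* a :+ (:- (β :* (c :* p))) :* z :=
            c :* (a :+ (:- (β :* p)) :* z)) ≈-refl c (v i) β ⟨ z , v ⟩ (z i))
    ; preserves = H-preserves
    }

  H-fixes : ∀ {v} → ⟨ z , v ⟩ ≈ 0# → H v ≈ᵥ v
  H-fixes {v} z⊥v i = ≈-trans
    (+-cong ≈-refl (*-cong (-‿cong (*-cong ≈-refl z⊥v)) ≈-refl))
    (solve 3 (λ x β z → x :+ (:- (β :* con 0ℚ)) :* z := x) ≈-refl (v i) β (z i))

  H-translates : ∀ {v} → ⟨ z , v ⟩ ≈ α → H v ≈ᵥ v +ᵥ (- 1#) *ᵥ z
  H-translates {v} zv≈α i = +-cong ≈-refl
    (*-cong (-‿cong (≈-trans (*-cong ≈-refl zv≈α) βα≈1)) ≈-refl)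

-- `fixes` is what allows such maps to be composed: a later one leaves alone the vectors that are
-- already in place.
record Transport {d} (e f : ℂ^ d) : Set where
  field
    isometry : Isometry d d
    phase    : ℂ
    maps     : ⟦ isometry ⟧ (phase *ᵥ f) ≈ᵥ e
    fixes    : ∀ {v} → ⟨ e , v ⟩ ≈ 0# → ⟨ f , v ⟩ ≈ 0# → ⟦ isometry ⟧ v ≈ᵥ v

module _ {d} (e f : ℂ^ d) (e-unit : ⟨ e , e ⟩ ≈ 1#) (f-unit : ⟨ f , f ⟩ ≈ 1#) where

  -- With `g = ωf` and `z = g - e` one has `⟨z,g⟩ = 1 - ω⟨e,f⟩ = α` and `⟨z,e⟩ = -conj α`. Hence
  -- `⟨z,z⟩ = α + conj α`, as the Householder map demands, and `g` goes to `g - z = e`. Positivity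
  -- of `re α` provides the reciprocal.
  transport-phase : ∀ ω → conj ω * ω ≈ 1# →
    Positive (re (1# + - (ω * ⟨ e , f ⟩))) → Transport e f
  transport-phase ω ω̄ω≈1 α>0 = record
    { isometry = Reflection.isometry
    ; phase    = ω
    ; maps     = λ i → ≈-trans (Reflection.H-translates ⟨z,g⟩ i)
        (solve 2 (λ g e → g :+ (:- con 1ℚ) :* (g :+ (:- con 1ℚ) :* e) := e) ≈-refl (g i) (e i))
    ; fixes    = λ {v} e⊥v f⊥v → Reflection.H-fixes {v} (begin
        ⟨ z , v ⟩                             ≈⟨ ⟨⟩-+ˡ g ((- 1#) *ᵥ e) v ⟩
        ⟨ g , v ⟩ + ⟨ (- 1#) *ᵥ e , v ⟩       ≈⟨ +-cong (⟨⟩-scaleˡ≈0 ω {f} {v} f⊥v) (⟨⟩-scaleˡ≈0 (- 1#) {e} {v} e⊥v) ⟩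
        0# + 0#                               ≈⟨ +-identityˡ 0# ⟩
        0#                                    ∎)
    }
    where
    g z : ℂ^ d
    g = ω *ᵥ f
    z = g +ᵥ (- 1#) *ᵥ e
    u α : ℂ
    u = ω * ⟨ e , f ⟩
    α = 1# + - u

    conj-−1 : conj (- 1#) ≈ - 1#
    conj-−1 = ≈-trans (conj-neg 1#) (-‿cong conj-1)

    ⟨e,g⟩ : ⟨ e , g ⟩ ≈ u
    ⟨e,g⟩ = ⟨⟩-*ʳ ω e f

    ⟨g,g⟩ : ⟨ g , g ⟩ ≈ 1#
    ⟨g,g⟩ = begin
      ⟨ g , g ⟩                      ≈⟨ ⟨⟩-*ˡ ω f g ⟩
      conj ω * ⟨ f , g ⟩             ≈⟨ *-cong ≈-refl (≈-trans (⟨⟩-*ʳ ω f f) (*-cong ≈-refl f-unit)) ⟩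
      conj ω * (ω * 1#)              ≈⟨ *-cong ≈-refl (*-identityʳ ω) ⟩
      conj ω * ω                     ≈⟨ ω̄ω≈1 ⟩
      1#                             ∎

    ⟨z,-⟩-expand : ∀ v → ⟨ z , v ⟩ ≈ ⟨ g , v ⟩ + - ⟨ e , v ⟩
    ⟨z,-⟩-expand v = begin
      ⟨ z , v ⟩                             ≈⟨ ⟨⟩-+ˡ g ((- 1#) *ᵥ e) v ⟩
      ⟨ g , v ⟩ + ⟨ (- 1#) *ᵥ e , v ⟩       ≈⟨ +-cong ≈-refl (≈-trans (⟨⟩-*ˡ (- 1#) e v) (*-cong conj-−1 ≈-refl)) ⟩
      ⟨ g , v ⟩ + (- 1#) * ⟨ e , v ⟩        ≈⟨ solve 2 (λ a b → a :+ (:- con 1ℚ) :* b := a :- b) ≈-refl ⟨ g , v ⟩ ⟨ e , v ⟩ ⟩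
      ⟨ g , v ⟩ + - ⟨ e , v ⟩               ∎

    ⟨z,g⟩ : ⟨ z , g ⟩ ≈ α
    ⟨z,g⟩ = ≈-trans (⟨z,-⟩-expand g) (+-cong ⟨g,g⟩ (-‿cong ⟨e,g⟩))

    ⟨z,e⟩ : ⟨ z , e ⟩ ≈ conj u + - 1#
    ⟨z,e⟩ = ≈-trans (⟨z,-⟩-expand e)
      (+-cong (≈-trans (⟨⟩-conj g e) (conj-cong ⟨e,g⟩)) (-‿cong e-unit))

    conj-α : conj α ≈ 1# + - conj u
    conj-α = ≈-trans (conj-+ 1# (- u)) (+-cong conj-1 (conj-neg u))

    ⟨z,z⟩ : ⟨ z , z ⟩ ≈ α + conj α
    ⟨z,z⟩ = begin
      ⟨ z , z ⟩                                ≈⟨ ⟨⟩-+ʳ z g ((- 1#) *ᵥ e) ⟩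
      ⟨ z , g ⟩ + ⟨ z , (- 1#) *ᵥ e ⟩          ≈⟨ +-cong ⟨z,g⟩ (≈-trans (⟨⟩-*ʳ (- 1#) z e) (*-cong ≈-refl ⟨z,e⟩)) ⟩
      α + (- 1#) * (conj u + - 1#)             ≈⟨ +-cong ≈-refl (solve 1 (λ ū → (:- con 1ℚ) :* (ū :- con 1ℚ) := con 1ℚ :- ū) ≈-refl (conj u)) ⟩
      α + (1# + - conj u)                      ≈⟨ +-cong ≈-refl conj-α ⟨
      α + conj α                               ∎

    reciprocal-α : ∃[ β ] β * α ≈ 1#
    reciprocal-α = ℂ-reciprocal α α>0

    module Reflection = Householder z α (proj₁ reciprocal-α) ⟨z,z⟩ (proj₂ reciprocal-α)

  -- The real parts of 1 − ⟨e,f⟩ and 1 + ⟨e,f⟩ add up to 2, so one of them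
  -- is positive; which one decides between the phases 1 and −1.
  abstract
    transport : Transport e f
    transport =
      [ transport-phase 1# (≈-trans (*-cong conj-1 ≈-refl) (*-identityˡ 1#))
      , transport-phase (- 1#) (≈-trans (*-cong (≈-trans (conj-neg 1#) (-‿cong conj-1)) ≈-refl)
          (solve 0 ((:- con 1ℚ) :* (:- con 1ℚ) := con 1ℚ) ≈-refl))
      ]′ (positive-split (re a) (re b) (positive-resp-≈ᵣ (_≈_.re-≈ 2≈a+b)
           (positive-+-nonNeg 1ᵣ 1ᵣ positive-1 (λ n → ℚ.nonNegative⁻¹ 1ℚ))))
      where
      a b : ℂ
      a = 1# + - (1# * ⟨ e , f ⟩)
      b = 1# + - ((- 1#) * ⟨ e , f ⟩)
      2≈a+b : 1# + 1# ≈ a + b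
      2≈a+b = solve 1 (λ u → con 1ℚ :+ con 1ℚ :=
        (con 1ℚ :- con 1ℚ :* u) :+ (con 1ℚ :- (:- con 1ℚ) :* u)) ≈-refl ⟨ e , f ⟩

-- Alignment of subspaces

sum-0 : ∀ {n} (f : Vector ℂ n) → (∀ i → f i ≈ 0#) → sum f ≈ 0#
sum-0 {zero}  f h = ≈-refl
sum-0 {suc n} f h = ≈-trans (+-cong (h zero) (sum-0 (tail f) (h ∘ suc))) (+-identityˡ 0#)

independent⇒head-nonzero : ∀ {r d} (b : Vector (ℂ^ d) (suc r)) →
  LinearlyIndependent b → Nonzero (b zero)
independent⇒head-nonzero b ind = nonzero-resp-≈ᵥ
  (λ i → ≈-trans (+-cong (*-identityˡ (b zero i)) (sum-0 _ (λ j → zeroˡ (b (suc j) i))))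
    (+-identityʳ (b zero i)))
  -- The coefficients `(1, 0, ..., 0)` have an entry apart from zero, and their combination is
  -- `b zero`.
  (ind (1# ∷ λ _ → 0#) (zero , 1#0))

combination-closed : ∀ {r d} (S : Subspace d) (c : Vector ℂ r) (b : Vector (ℂ^ d) r) →
  (∀ j → Member S (b j)) → Member S (combination c b)
combination-closed {zero}  S c b h = 0-closed S
combination-closed {suc r} S c b h = +-closed S (*-closed S (c zero) (h zero))
  (combination-closed S (tail c) (tail b) (h ∘ suc))

module _ {r d} (b : Vector (ℂ^ d) (suc r)) (a : ℂ) (μ : Vector ℂ r) where

  sheared-tail : Vector (ℂ^ d) r
  sheared-tail j = b (suc j) +ᵥ μ j *ᵥ (a *ᵥ b zero)

  -- A combination of the sheared vectors is a combination of `b` with the same tail of coefficients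
  -- and a head `γ` collecting the shears. An entry of the tail apart from zero is enough, whatever
  -- `γ` is.
  sheared-tail-independent : LinearlyIndependent b → LinearlyIndependent sheared-tail
  sheared-tail-independent ind c (j , cⱼ#0) =
    nonzero-resp-≈ᵥ same (ind (γ ∷ c) (suc j , cⱼ#0))
    where
    γ : ℂ
    γ = sum (λ j → c j * μ j * a)
    same : combination (γ ∷ c) b ≈ᵥ combination c sheared-tail
    same i = begin
      γ * b zero i + sum (λ j → c j * b (suc j) i)
        ≈⟨ +-cong (*-distribʳ-sum (b zero i) (λ j → c j * μ j * a)) ≈-refl ⟩
      sum (λ j → c j * μ j * a * b zero i) + sum (λ j → c j * b (suc j) i)
        ≈⟨ ∑-distrib-+ (λ j → c j * μ j * a * b zero i) (λ j → c j * b (suc j) i) ⟨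
      sum (λ j → c j * μ j * a * b zero i + c j * b (suc j) i)
        ≈⟨ sum-cong-≋ (λ j → solve 5 (λ c μ a x y →
             c :* μ :* a :* x :+ c :* y := c :* (y :+ μ :* (a :* x))) ≈-refl
             (c j) (μ j) a (b zero i) (b (suc j) i)) ⟩
      sum (λ j → c j * (b (suc j) i + μ j * (a * b zero i)))
        ∎

-- A single step: only the head is normalised, and `rest` is made orthogonal to it. The recursion of
-- `align-vectors` performs the later steps, interleaved with the Householder maps.
module GramSchmidt {r d} (b : Vector (ℂ^ d) (suc r)) (ind : LinearlyIndependent b) where

  open Normalisation (normalise (b zero) (independent⇒head-nonzero b ind)) public
    renaming (direction to e)

  μ : Vector ℂ r
  μ j = - ⟨ e , b (suc j) ⟩

  rest : Vector (ℂ^ d) r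
  rest = sheared-tail b factor μ

  rest-independent : LinearlyIndependent rest
  rest-independent = sheared-tail-independent b factor μ ind

  rest⊥e : ∀ j → ⟨ rest j , e ⟩ ≈ 0#
  rest⊥e j = begin
    ⟨ rest j , e ⟩                               ≈⟨ ⟨⟩-+ˡ (b (suc j)) (μ j *ᵥ e) e ⟩
    ⟨ b (suc j) , e ⟩ + ⟨ μ j *ᵥ e , e ⟩         ≈⟨ +-cong (⟨⟩-conj (b (suc j)) e)
                                                      (≈-trans (⟨⟩-*ˡ (μ j) e e) (*-cong (conj-neg p) unit)) ⟩
    conj p + (- conj p) * 1#                     ≈⟨ solve 1 (λ x → x :+ (:- x) :* con 1ℚ := con 0ℚ) ≈-refl (conj p) ⟩
    0#                                           ∎
    where p = ⟨ e , b (suc j) ⟩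

  rest-recover : ∀ j → b (suc j) ≈ᵥ rest j +ᵥ ⟨ e , b (suc j) ⟩ *ᵥ e
  rest-recover j i = solve 3 (λ x p e → x := (x :+ (:- p) :* e) :+ p :* e) ≈-refl
    (b (suc j) i) ⟨ e , b (suc j) ⟩ (e i)

  module _ {v : ℂ^ d} (b⊥v : ∀ j → ⟨ b j , v ⟩ ≈ 0#) where

    e⊥ : ⟨ e , v ⟩ ≈ 0#
    e⊥ = ⟨⟩-scaleˡ≈0 factor {b zero} {v} (b⊥v zero)

    rest⊥ : ∀ j → ⟨ rest j , v ⟩ ≈ 0#
    rest⊥ j = begin
      ⟨ rest j , v ⟩                            ≈⟨ ⟨⟩-+ˡ (b (suc j)) (μ j *ᵥ e) v ⟩
      ⟨ b (suc j) , v ⟩ + ⟨ μ j *ᵥ e , v ⟩      ≈⟨ +-cong (b⊥v (suc j)) (⟨⟩-scaleˡ≈0 (μ j) {e} {v} e⊥) ⟩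
      0# + 0#                                   ≈⟨ +-identityˡ 0# ⟩
      0#                                        ∎

  module _ (S : Subspace d) where

    e∈ : Member S (b zero) → Member S e
    e∈ = *-closed S factor

    rest∈ : (∀ j → Member S (b j)) → ∀ j → Member S (rest j)
    rest∈ b∈S j = +-closed S (b∈S (suc j)) (*-closed S (μ j) (e∈ (b∈S zero)))

    b∈ : Member S e → (∀ j → Member S (rest j)) → ∀ j → Member S (b j)
    b∈ e∈S rest∈S zero    = resp-≈ S (λ i → ≈-sym (recover i)) (*-closed S inverse e∈S)
    b∈ e∈S rest∈S (suc j) = resp-≈ S (λ i → ≈-sym (rest-recover j i))
      (+-closed S (rest∈S j) (*-closed S ⟨ e , b (suc j) ⟩ e∈S))

⟨⟩-⟦⟧-fixed : ∀ {d} (U : Isometry d d) {v} (w : ℂ^ d) → ⟦ U ⟧ v ≈ᵥ v → ⟨ ⟦ U ⟧ w , v ⟩ ≈ ⟨ w , v ⟩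
⟨⟩-⟦⟧-fixed U {v} w Uv≈v =
  ≈-trans (⟨⟩-cong {v = ⟦ U ⟧ w} (λ _ → ≈-refl) (λ i → ≈-sym (Uv≈v i))) (preserves U w v)

-- The target is phrased with a subspace `T` containing the `y j`, since individual vectors are not
-- matched with each other; in the recursion `T` becomes its image under the first map. The fixing
-- clause is part of the induction because vectors placed earlier must survive the later maps.
align-vectors : ∀ r {d} (x y : Vector (ℂ^ d) r) (T : Subspace d) →
  LinearlyIndependent x → LinearlyIndependent y → (∀ j → Member T (y j)) →
  Σ[ U ∈ Isometry d d ]
    (∀ {v} → (∀ j → ⟨ x j , v ⟩ ≈ 0#) → (∀ j → ⟨ y j , v ⟩ ≈ 0#) → ⟦ U ⟧ v ≈ᵥ v) ×
    (∀ j → Member (image U T) (x j))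
align-vectors zero    x y T x-ind y-ind y∈T = id-isometry , (λ _ _ i → ≈-refl) , λ ()
align-vectors (suc r) {d} x y T x-ind y-ind y∈T = W ∘ᵢ H , fixes-⊥ , covers
  where
  module X = GramSchmidt x x-ind
  module Y = GramSchmidt y y-ind
  open Transport (transport X.e Y.e X.unit Y.unit) renaming (isometry to H)

  y′ : Vector (ℂ^ d) r
  y′ j = ⟦ H ⟧ (Y.rest j)

  aligned = align-vectors r X.rest y′ (image H T) X.rest-independent
    (image-independent H Y.rest Y.rest-independent)
    (λ j → Y.rest j , Y.rest∈ T y∈T j , λ i → ≈-refl)

  W : Isometry d d
  W = proj₁ aligned

  W-fixes : ∀ {v} → (∀ j → ⟨ X.rest j , v ⟩ ≈ 0#) → (∀ j → ⟨ y′ j , v ⟩ ≈ 0#) → ⟦ W ⟧ v ≈ᵥ v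
  W-fixes = proj₁ (proj₂ aligned)

  fixes-⊥ : ∀ {v} → (∀ j → ⟨ x j , v ⟩ ≈ 0#) → (∀ j → ⟨ y j , v ⟩ ≈ 0#) → ⟦ W ∘ᵢ H ⟧ v ≈ᵥ v
  fixes-⊥ {v} x⊥v y⊥v i = ≈-trans (⟦⟧-cong W Hv≈v i)
    -- As `H` fixes `v` and preserves inner products, `v` is orthogonal to `y′` just as it is to
    -- `Y.rest`.
    (W-fixes (X.rest⊥ {v} x⊥v) (λ j → ≈-trans (⟨⟩-⟦⟧-fixed H (Y.rest j) Hv≈v) (Y.rest⊥ {v} y⊥v j)) i)
    where
    Hv≈v : ⟦ H ⟧ v ≈ᵥ v
    Hv≈v = fixes {v} (X.e⊥ {v} x⊥v) (Y.e⊥ {v} y⊥v)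

  -- `X.e` is the image under `H` of a multiple of `Y.e`, and `Y.rest` is orthogonal to `Y.e`.
  y′⊥e : ∀ j → ⟨ y′ j , X.e ⟩ ≈ 0#
  y′⊥e j = begin
    ⟨ y′ j , X.e ⟩                        ≈⟨ ⟨⟩-cong {v = y′ j} (λ _ → ≈-refl) maps ⟨
    ⟨ y′ j , ⟦ H ⟧ (phase *ᵥ Y.e) ⟩       ≈⟨ preserves H (Y.rest j) (phase *ᵥ Y.e) ⟩
    ⟨ Y.rest j , phase *ᵥ Y.e ⟩           ≈⟨ ⟨⟩-scaleʳ≈0 phase {Y.rest j} {Y.e} (Y.rest⊥e j) ⟩
    0#                                    ∎

  covers : ∀ j → Member (image (W ∘ᵢ H) T) (x j)
  covers = X.b∈ (image (W ∘ᵢ H) T)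
    -- `W` fixes `X.e`, which is orthogonal to both of its families, so the preimage of `X.e` under
    -- `H` still serves for `W ∘ᵢ H`.
    ( phase *ᵥ Y.e , *-closed T phase (Y.e∈ T (y∈T zero))
    , λ i → ≈-sym (≈-trans (⟦⟧-cong W maps i) (W-fixes X.rest⊥e y′⊥e i)))
    (λ j → image-∘ W H T (proj₂ (proj₂ aligned) j))

infix 4 _⟂_ _⊆ₛ_

_⟂_ : ∀ {d} → ℂ^ d → Subspace d → Set
v ⟂ S = ∀ {w} → Member S w → ⟨ w , v ⟩ ≈ 0#

_⊆ₛ_ : ∀ {d} → Subspace d → Subspace d → Set
S ⊆ₛ T = ∀ {v} → Member S v → Member T v

⟂-image : ∀ {d} (U : Isometry d d) {T} {v w} → w ≈ᵥ ⟦ U ⟧ v → v ⟂ T → w ⟂ image U T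
⟂-image U {v = v} w≈Uv v⟂T (t , t∈T , x≈Ut) =
  ≈-trans (⟨⟩-cong x≈Ut w≈Uv) (≈-trans (preserves U t v) (v⟂T t∈T))

align-subspaces : ∀ {r d} (S T : Subspace d) → HasDimension S r → HasDimension T r →
  Σ[ U ∈ Isometry d d ] (∀ {v} → v ⟂ S → v ⟂ T → ⟦ U ⟧ v ≈ᵥ v) × S ⊆ₛ image U T
align-subspaces {r} S T (x , x-basis) (y , y-basis) =
  let U , fixes-⊥ , covers = align-vectors r x y T
        (IsBasis.independent x-basis) (IsBasis.independent y-basis) (IsBasis.members y-basis)
  in U
  , (λ v⟂S v⟂T → fixes-⊥ (λ j → v⟂S (IsBasis.members x-basis j)) (λ j → v⟂T (IsBasis.members y-basis j)))
  , λ v∈S → let c , v≈cx = IsBasis.spanning x-basis v∈S in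
      resp-≈ (image U T) (λ i → ≈-sym (v≈cx i)) (combination-closed (image U T) c x covers)

Aligns : ∀ {n d} → Pred (Fin n) 0ℓ → (S T : Fin n → Subspace d) → Isometry d d → Set
Aligns P S T U =
  (∀ {v} → (∀ i → P i → v ⟂ S i) → (∀ i → P i → v ⟂ T i) → ⟦ U ⟧ v ≈ᵥ v) ×
  (∀ i → P i → S i ⊆ₛ image U (T i))

abstract
  -- Induction over the indices: `H` brings the image of `T zero` over `S zero`, then `W` aligns the
  -- remaining `S i` with the moved `T i`. Pairwise orthogonality makes `W` fix all of `S zero`, so
  -- the first inclusion survives.
  align-families : ∀ n {r d} {P : Pred (Fin n) 0ℓ} → Decidable P → (S T : Fin n → Subspace d) →
    (∀ i → P i → HasDimension (S i) r) → (∀ i → P i → HasDimension (T i) r) →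
    (∀ i j → P i → P j → i ≢ j → S i ⊥ S j) → (∀ i j → P i → P j → i ≢ j → T i ⊥ T j) →
    Σ[ U ∈ Isometry d d ] Aligns P S T U
  align-families zero P? S T dimS dimT S⊥ T⊥ = id-isometry , (λ _ _ i → ≈-refl) , λ ()
  align-families (suc n) {r} {d} {P} P? S T dimS dimT S⊥ T⊥ = step (P? zero)
    where
    suc-≢ : ∀ {i j : Fin n} → i ≢ j → suc i ≢ suc j
    suc-≢ i≢j refl = i≢j refl

    align-tail : (T′ : Fin n → Subspace d) → (∀ i → P (suc i) → HasDimension (T′ i) r) →
      (∀ i j → P (suc i) → P (suc j) → i ≢ j → T′ i ⊥ T′ j) →
      Σ[ U ∈ Isometry d d ] Aligns (P ∘ suc) (S ∘ suc) T′ U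
    align-tail T′ dimT′ T′⊥ = align-families n (P? ∘ suc) (S ∘ suc) T′ (dimS ∘ suc) dimT′
      (λ i j pi pj i≢j → S⊥ (suc i) (suc j) pi pj (suc-≢ i≢j)) T′⊥

    step : Dec (P zero) → Σ[ U ∈ Isometry d d ] Aligns P S T U
    step (no ¬p) =
      let U , U-fixes , U-covers = align-tail (T ∘ suc) (dimT ∘ suc)
            (λ i j pi pj i≢j → T⊥ (suc i) (suc j) pi pj (suc-≢ i≢j))
      in U , (λ v⟂S v⟂T → U-fixes (v⟂S ∘ suc) (v⟂T ∘ suc))
           , λ { zero p → contradiction p ¬p ; (suc i) p → U-covers i p }
    step (yes p) =
      let H , H-fixes , H-covers = align-subspaces (S zero) (T zero) (dimS zero p) (dimT zero p)
          W , W-fixes , W-covers = align-tail (λ i → image H (T (suc i)))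
            (λ i pi → image-dimension H {T (suc i)} (dimT (suc i) pi))
            (λ i j pi pj i≢j → image-⊥ H {T (suc i)} {T (suc j)} (T⊥ (suc i) (suc j) pi pj (suc-≢ i≢j)))
      in W ∘ᵢ H
      , (λ {v} v⟂S v⟂T →
          let Hv≈v = H-fixes (v⟂S zero p) (v⟂T zero p) in λ k →
          ≈-trans (⟦⟧-cong W Hv≈v k) (W-fixes (λ i pi → v⟂S (suc i) pi)
            (λ i pi → ⟂-image H {T (suc i)} (λ k → ≈-sym (Hv≈v k)) (v⟂T (suc i) pi)) k))
      , λ { zero _ {s} s∈S →
              let t , t∈T , s≈Ht = H-covers s∈S
                  -- `s` is orthogonal to each later `S i` directly, and to each moved `T i` because
                  -- `s = H t` with `t` in `T zero`, which is orthogonal to `T i`.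
                  Ws≈s = W-fixes {s}
                    (λ i pi w∈S → S⊥ (suc i) zero pi p (λ ()) w∈S s∈S)
                    (λ i pi → ⟂-image H {T (suc i)} s≈Ht
                      (λ t′∈T → T⊥ (suc i) zero pi p (λ ()) t′∈T t∈T))
              in t , t∈T , λ k → ≈-trans (≈-sym (Ws≈s k)) (⟦⟧-cong W s≈Ht k)
          ; (suc i) pi s∈S → image-∘ W H (T (suc i)) (W-covers i pi s∈S) }

-- Representations of graphs

-- A representation with a subspace attached to every index, so that the
-- subspace does not depend on a proof that the index is a vertex.
record TotalRep {N} (d r : ℕ) (G : Graph N) : Set₁ where
  field
    space      : Fin N → Subspace d
    dimension  : ∀ {u} → u ∈ V G → HasDimension (space u) r
    orthogonal : ∀ {u v} → Adj G u v → space u ⊥ space v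

-- The placeholder at indices outside the vertex set, which no edge reaches.
zeroSubspace : ∀ {d} → Subspace d
zeroSubspace = record
  { Member   = λ v → v ≈ᵥ 0ᵥ
  ; resp-≈   = λ v≈w v≈0 i → ≈-trans (≈-sym (v≈w i)) (v≈0 i)
  ; 0-closed = λ i → ≈-refl
  ; +-closed = λ v≈0 w≈0 i → ≈-trans (+-cong (v≈0 i) (w≈0 i)) (+-identityˡ 0#)
  ; *-closed = λ c v≈0 i → ≈-trans (*-cong ≈-refl (v≈0 i)) (zeroʳ c)
  }

totalise : ∀ {N d r} {G : Graph N} → OrthogonalSubspaceRep d r G → TotalRep d r G
totalise {d = d} {r} {G} R = record
  { space      = λ u → at u (u ∈? V G)
  ; dimension  = λ {u} u∈V → at-dimension u∈V (u ∈? V G)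
  ; orthogonal = λ {u} {v} uv → at-orthogonal uv (u ∈? V G) (v ∈? V G)
  }
  where
  module R = OrthogonalSubspaceRep R
  at : ∀ u → Dec (u ∈ V G) → Subspace d
  at u (yes p) = R.space (u , p)
  at u (no _)  = zeroSubspace
  at-dimension : ∀ {u} → u ∈ V G → (u? : Dec (u ∈ V G)) → HasDimension (at u u?) r
  at-dimension u∈V (yes p) = R.dimension (_ , p)
  at-dimension u∈V (no u∉V) = contradiction u∈V u∉V
  at-orthogonal : ∀ {u v} → Adj G u v → (u? : Dec (u ∈ V G)) (v? : Dec (v ∈ V G)) → at u u? ⊥ at v v?
  at-orthogonal uv (yes p) (yes q) = R.orthogonal (_ , p) (_ , q) uv
  at-orthogonal uv (no u∉V) _      = contradiction (proj₁ (adj-∈ G uv)) u∉V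
  at-orthogonal uv (yes _) (no v∉V) = contradiction (proj₂ (adj-∈ G uv)) v∉V

untotalise : ∀ {N d r} {G : Graph N} → TotalRep d r G → OrthogonalSubspaceRep d r G
untotalise R = record
  { space      = λ u → space (proj₁ u)
  ; dimension  = λ u → dimension (proj₂ u)
  ; orthogonal = λ u v uv → orthogonal uv
  }
  where open TotalRep R

image-rep : ∀ {N m n r} {G : Graph N} → Isometry m n → TotalRep m r G → TotalRep n r G
image-rep U R = record
  { space      = λ u → image U (space u)
  ; dimension  = λ {u} u∈V → image-dimension U {space u} (dimension u∈V)
  ; orthogonal = λ {u} {v} uv → image-⊥ U {space u} {space v} (orthogonal uv)
  }
  where open TotalRep R

restrict-rep : ∀ {N d r} {H G : Graph N} → IsInducedSubgraph H G →
  OrthogonalSubspaceRep d r G → OrthogonalSubspaceRep d r H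
restrict-rep {H = H} {G} H⊆G R = record
  { space      = λ u → R.space (inc u)
  ; dimension  = λ u → R.dimension (inc u)
  ; orthogonal = λ u v uv → R.orthogonal (inc u) (inc v)
      (Equivalence.to (IsInducedSubgraph.edges H⊆G (proj₂ u) (proj₂ v)) uv)
  }
  where
  module R = OrthogonalSubspaceRep R
  inc : Vertex H → Vertex G
  inc (u , u∈H) = u , IsInducedSubgraph.vertices H⊆G u∈H

-- Gluing two representations along the clique

module _ {N t d r} {G₁ G₂ G : Graph N} (cs : IsCliqueSum t G₁ G₂ G)
         (R₁ : TotalRep d r G₁) (R₂ : TotalRep d r G₂) where
  private
    module R₁ = TotalRep R₁
    module R₂ = TotalRep R₂
    open IsCliqueSum cs

    Shared : Pred (Fin N) 0ℓ
    Shared u = u ∈ V G₁ × u ∈ V G₂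

    shared-adj : ∀ u v → Shared u → Shared v → u ≢ v → Adj G₁ u v × Adj G₂ u v
    shared-adj u v p q = complete (x∈p∩q⁺ p) (x∈p∩q⁺ q)

    aligned = align-families N (λ u → (u ∈? V G₁) ×-dec (u ∈? V G₂)) R₁.space R₂.space
      (λ u p → R₁.dimension (proj₁ p)) (λ u p → R₂.dimension (proj₂ p))
      (λ u v p q u≢v → R₁.orthogonal (proj₁ (shared-adj u v p q u≢v)))
      (λ u v p q u≢v → R₂.orthogonal (proj₂ (shared-adj u v p q u≢v)))

    U : Isometry d d
    U = proj₁ aligned

    module R₂′ = TotalRep (image-rep U R₂)

    shared-⊆ : ∀ {u} → u ∈ V G₁ → u ∈ V G₂ → R₁.space u ⊆ₛ R₂′.space u
    shared-⊆ {u} u∈₁ u∈₂ = proj₂ (proj₂ aligned) u (u∈₁ , u∈₂)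

    at : ∀ u → Dec (u ∈ V G₁) → Subspace d
    at u (yes _) = R₁.space u
    at u (no _)  = R₂′.space u

    at-dimension : ∀ {u} → u ∈ V G → (u? : Dec (u ∈ V G₁)) → HasDimension (at u u?) r
    at-dimension u∈V (yes u∈₁) = R₁.dimension u∈₁
    at-dimension {u} u∈V (no u∉₁) =
      [ (λ u∈₁ → contradiction u∈₁ u∉₁) , R₂′.dimension ]′
      (x∈p∪q⁻ (V G₁) (V G₂) (subst (u ∈_) vertices u∈V))

    -- The reason edges of `G₂` stay orthogonal: even where the space of `R₁` is used, it sits
    -- inside the moved space of `R₂`.
    ⊆-at : ∀ {u} → u ∈ V G₂ → (u? : Dec (u ∈ V G₁)) → at u u? ⊆ₛ R₂′.space u
    ⊆-at u∈₂ (yes u∈₁) = shared-⊆ u∈₁ u∈₂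
    ⊆-at u∈₂ (no _)    = λ v∈ → v∈

    at-⊥₂ : ∀ {u v} → Adj G₂ u v → (u? : Dec (u ∈ V G₁)) (v? : Dec (v ∈ V G₁)) → at u u? ⊥ at v v?
    at-⊥₂ uv u? v? x∈ y∈ = R₂′.orthogonal uv
      (⊆-at (proj₁ (adj-∈ G₂ uv)) u? x∈) (⊆-at (proj₂ (adj-∈ G₂ uv)) v? y∈)

    at-⊥₁ : ∀ {u v} → Adj G₁ u v → (u? : Dec (u ∈ V G₁)) (v? : Dec (v ∈ V G₁)) → at u u? ⊥ at v v?
    at-⊥₁ uv (yes _) (yes _)  = R₁.orthogonal uv
    at-⊥₁ uv (no u∉₁) _       = contradiction (proj₁ (adj-∈ G₁ uv)) u∉₁
    at-⊥₁ uv (yes _) (no v∉₁) = contradiction (proj₂ (adj-∈ G₁ uv)) v∉₁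

  glue : TotalRep d r G
  glue = record
    { space      = λ u → at u (u ∈? V G₁)
    ; dimension  = λ {u} u∈V → at-dimension u∈V (u ∈? V G₁)
    ; orthogonal = λ {u} {v} uv →
        [ (λ uv₁ → at-⊥₁ uv₁ (u ∈? V G₁) (v ∈? V G₁)) , (λ uv₂ → at-⊥₂ uv₂ (u ∈? V G₁) (v ∈? V G₁)) ]′
        (Equivalence.to (edges u v) uv)
    }

mainTheorem14 : ∀ {N : ℕ} (t r : ℕ) (G₁ G₂ G : Graph N) → IsCliqueSum t G₁ G₂ G →
    ∀ (d₁ d₂ : ℕ) → ξ[ r ] G₁ ≔ d₁ → ξ[ r ] G₂ ≔ d₂ → ξ[ r ] G ≔ (d₁ ⊔ d₂)
mainTheorem14 t r G₁ G₂ G cs d₁ d₂ ξ₁ ξ₂ = record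
  { attained = untotalise (glue cs
      (image-rep (padding (ℕ.≤⇒≤′ (ℕ.m≤m⊔n d₁ d₂))) (totalise (attained ξ₁)))
      (image-rep (padding (ℕ.≤⇒≤′ (ℕ.m≤n⊔m d₁ d₂))) (totalise (attained ξ₂))))
  ; least = λ d R → ℕ.⊔-lub (least ξ₁ d (restrict-rep induced₁ R)) (least ξ₂ d (restrict-rep induced₂ R))
  }
  where
  open ξ[_]_≔_
  open IsCliqueSum cs
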